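{- Let $k,m$ be positive integers with $m\ge 5$ and let $b\in\{0,2,4,\ldots\}$. If $b\equiv 0\pmod 4$, then $$U_{k\varphi(5^m)+b}-(1+5^b)U_b\equiv 5^{m-1}k(7545+5050b-5375b^2+1250b^3+3125b^4+9375b^5)\pmod{5^{m+5}}.$$ If $b\equiv 2\pmod 4$, then $$U_{k\varphi(5^m)+b}-(1+5^b)U_b\equiv 5^{m-1}k(-1575+5350b+2250b^2+7500b^3+3125b^5)\pmod{5^{m+5}}.$$
   Context: The integer sequence $\{U_n\}_{n\ge0}$ is defined by $U_0=1$ and $U_n=-2\sum_{j=1}^{\lfloor n/2\rfloor}\binom{n}{2j}U_{n-2j}$ for $n\ge 1$. $\varphi$ denotes Euler's totient function. -}

module Defs where

open import Data.Fin.Base using (toℕ)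
open import Data.Integer.Base using (ℤ; +_; 1ℤ; _-_; _*_; -_)
open import Data.Integer.Divisibility.Signed using (_∣_)
open import Data.Integer.Properties using (+-0-monoid)
open import Data.List.Base using (length; filter; map; upTo)
open import Data.Nat.Base as ℕ using (ℕ; zero; suc; _<_; _∸_; s≤s; ⌊_/2⌋)
open import Data.Nat.Combinatorics using (_C_)
open import Data.Nat.Coprimality using (coprime?)
open import Data.Nat.Induction using (<-Rec; <-rec; <-wellFounded)
open import Data.Nat.Properties using (m∸n≤m)
open import Induction.WellFounded using (module FixPoint)
open import Relation.Binary.PropositionalEquality using (_≡_; refl; cong)

open import Algebra.Properties.Monoid.Sum +-0-monoid
  using (sum-syntax; sum-cong-≗)

infix 4 _≡_[mod_]

_≡_[mod_] : ℤ → ℤ → ℕ → Set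
x ≡ y [mod n ] = + n ∣ x - y

φ : ℕ → ℕ
φ n = length (filter (λ a → coprime? a n) (map suc (upTo n)))

private
  descent : ∀ n (j : ℕ) → suc n ∸ 2 ℕ.* suc j < suc n
  descent n j = s≤s (m∸n≤m n (j ℕ.+ (suc j ℕ.+ 0)))

  -- The summation index runs over j = 0 , … , ⌊n/2⌋ - 1, so suc j takes the
  -- values 1 , … , ⌊n/2⌋ (whence 2 * suc j ≤ n and ∸ never truncates).
  U-step : ∀ n → <-Rec (λ _ → ℤ) n → ℤ
  U-step zero        U = 1ℤ
  U-step n@(suc n-1) U =
    - (+ 2) * ∑[ j < ⌊ n /2⌋ ]
      (+ (n C (2 ℕ.* suc (toℕ j))) * U (descent n-1 (toℕ j)))

  U-step-ext : ∀ n {f g : <-Rec (λ _ → ℤ) n} →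
               (∀ {k} (k<n : k < n) → f k<n ≡ g k<n) → U-step n f ≡ U-step n g
  U-step-ext zero        f≗g = refl
  U-step-ext n@(suc n-1) f≗g =
    cong (- (+ 2) *_) (sum-cong-≗ {⌊ n /2⌋} λ j →
      cong (+ (n C (2 ℕ.* suc (toℕ j))) *_) (f≗g (descent n-1 (toℕ j))))

U : ℕ → ℤ
U = <-rec (λ _ → ℤ) U-step

U-zero : U 0 ≡ 1ℤ
U-zero = refl

U-suc : ∀ n-1 → let n = suc n-1 in
        U n ≡ - (+ 2) * ∑[ j < ⌊ n /2⌋ ]
          (+ (n C (2 ℕ.* suc (toℕ j))) * U (n ∸ 2 ℕ.* suc (toℕ j)))
U-suc n-1 =
  FixPoint.unfold-wfRec <-wellFounded (λ _ → ℤ) U-step U-step-ext {suc n-1}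

{-# OPTIONS --safe #-}

-- With s j the 6-periodic coefficients 0, 1, 1, 0, -1, -1 of x / (x² - x + 1),
-- the sums S n L = Σ_{j<L} s j · jⁿ over L an odd multiple of 3 · 5ᴹ telescope to the
-- recurrence of 2 U n modulo 5ᴹ.  Removing the multiples of 5 from such a sum
-- multiplies U n by 1 + 5ⁿ and leaves a combination of n-th powers of
-- units mod 5, whose fourth powers are ≡ 1 mod 5; hence f a = (1 + 5ⁿ) U n, n = r + 4 a,
-- satisfies the Kummer congruences 5ⁱ ∣ Δⁱ f.  For such f and 5ᵐ ∣ K, Newton's
-- forward formula gives f (a + K) - f a ≡ K log (1 + Δ) f a modulo 5ᵐ⁺⁶, where only
-- five terms of the logarithm survive.  As a function of a, log (1 + Δ) f is a
-- polynomial of degree < 6 modulo 5⁶, so it is determined by its first six values.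

module Submission where

open import Data.Fin.Base using (toℕ)
open import Data.Fin.Properties using (toℕ<n)
open import Data.Integer.Base as ℤ using (ℤ; +_; _+_; _-_; _*_; _^_; -_; 0ℤ; 1ℤ; -1ℤ)
open import Data.Integer.Divisibility.Signed as ℤ
  using (divides; ∣m∣n⇒∣m+n; ∣m∣n⇒∣m-n; ∣n⇒∣m*n; ∣m⇒∣m*n; ∣ᵤ⇒∣; ∣⇒∣ᵤ; *-cancelˡ-∣)
  renaming (_∣_ to _∣ℤ_)
open import Data.Integer.Properties as ℤ using (+-*-semiring; pos-+; pos-*)
open import Data.Integer.Tactic.RingSolver using (solve-∀)
open import Data.List.Base using (List; []; _∷_; length; filter; applyUpTo)
open import Data.List.Properties using (map-applyUpTo; filter-accept; filter-reject)
open import Data.Nat.Base as ℕ using (ℕ; zero; suc; _≤_; _<_; _∸_; z≤n; s≤s; ⌊_/2⌋; _!)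
open import Data.Nat.Combinatorics using (_C_; nC1≡n; nCk+nC[k+1]≡[n+1]C[k+1]; k>n⇒nCk≡0)
open import Data.Nat.Coprimality using (Coprime; coprime?)
open import Data.Nat.Divisibility as ℕ using (_∣_; _∣?_)
open import Data.Nat.Induction using (<-rec)
open import Data.Nat.Primality using (Prime; prime?; euclidsLemma; prime⇒nonZero)
import Data.Nat.Properties as ℕ
import Data.Nat.Tactic.RingSolver as ℕ-Solver
open import Data.Product.Base using (_×_; _,_; ∃-syntax; proj₁; proj₂)
open import Data.Sum.Base using (inj₁; inj₂)
open import Data.Vec.Base as Vec using (Vec; []; _∷_)
open import Defs using (U; U-suc; φ; _≡_[mod_])
open import Function.Base using (_∘_; id)
open import Function.Bundles using (_⇔_; mk⇔; Equivalence)
open import Level using (0ℓ)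
open import Relation.Binary.PropositionalEquality
open import Relation.Nullary using (¬_; contradiction; yes; no)
open import Relation.Nullary.Decidable using (from-yes; from-no)
open import Relation.Unary using (Pred; Decidable)

open import Algebra.Properties.Semiring.Sum +-*-semiring
  using (sum; sum-cong-≗; ∑-distrib-+; ∑-comm; *-distribˡ-sum)

open ≡-Reasoning

-- Sums and binomial expansions

∑< : ℕ → (ℕ → ℤ) → ℤ
∑< n g = sum {n} (g ∘ toℕ)

∑<-cong : ∀ n {g h} → (∀ i → i < n → g i ≡ h i) → ∑< n g ≡ ∑< n h
∑<-cong n g≗h = sum-cong-≗ {n} (λ i → g≗h (toℕ i) (toℕ<n i))

∑<-+ : ∀ n g h → ∑< n (λ i → g i + h i) ≡ ∑< n g + ∑< n h
∑<-+ n g h = ∑-distrib-+ {n} (g ∘ toℕ) (h ∘ toℕ)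

∑<-*ˡ : ∀ n x g → ∑< n (λ i → x * g i) ≡ x * ∑< n g
∑<-*ˡ n x g = sym (*-distribˡ-sum {n} x (g ∘ toℕ))

∑<-suc : ∀ n g → ∑< (suc n) g ≡ ∑< n g + g n
∑<-suc zero    g = ℤ.+-comm (g 0) 0ℤ
∑<-suc (suc n) g = begin
  g 0 + ∑< (suc n) (g ∘ suc)       ≡⟨ cong (_+_ (g 0)) (∑<-suc n (g ∘ suc)) ⟩
  g 0 + (∑< n (g ∘ suc) + g (suc n)) ≡⟨ ℤ.+-assoc (g 0) _ _ ⟨
  g 0 + ∑< n (g ∘ suc) + g (suc n) ∎

∑<-comm : ∀ m n (g : ℕ → ℕ → ℤ) →
  ∑< m (λ i → ∑< n (g i)) ≡ ∑< n (λ j → ∑< m (λ i → g i j))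
∑<-comm m n g = ∑-comm {m} {n} (λ i j → g (toℕ i) (toℕ j))

binomialSum : ℕ → (ℕ → ℕ → ℤ) → ℤ
binomialSum n F = ∑< (suc n) (λ i → + (n C i) * F i (n ∸ i))

binomialSum-suc : ∀ n F →
  binomialSum n (λ i l → F (suc i) l + F i (suc l)) ≡ binomialSum (suc n) F
binomialSum-suc n F = begin
  ∑< (suc n) (λ i → c i * (F (suc i) (n ∸ i) + F i (suc (n ∸ i))))
    ≡⟨ ∑<-cong (suc n) (λ i i<1+n → trans (ℤ.*-distribˡ-+ (c i) _ _)
         (cong (λ l → c i * F (suc i) (n ∸ i) + c i * F i l) (sym (ℕ.+-∸-assoc 1 (ℕ.≤-pred i<1+n))))) ⟩
  ∑< (suc n) (λ i → g i + h i)
    ≡⟨ ∑<-+ (suc n) g h ⟩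
  ∑< (suc n) g + ∑< (suc n) h
    ≡⟨ cong (_+_ (∑< (suc n) g)) (trans (sym (ℤ.+-identityʳ _)) (cong (_+_ (∑< (suc n) h)) (sym last≡0))) ⟩
  ∑< (suc n) g + (∑< (suc n) h + h (suc n))
    ≡⟨ cong (_+_ (∑< (suc n) g)) (∑<-suc (suc n) h) ⟨
  ∑< (suc n) g + (h 0 + ∑< (suc n) (h ∘ suc))
    ≡⟨ swap (∑< (suc n) g) (h 0) (∑< (suc n) (h ∘ suc)) ⟩
  h 0 + (∑< (suc n) g + ∑< (suc n) (h ∘ suc))
    ≡⟨ cong (_+_ (h 0)) (∑<-+ (suc n) g (h ∘ suc)) ⟨
  h 0 + ∑< (suc n) (λ i → g i + h (suc i))
    ≡⟨ cong (_+_ (h 0)) (∑<-cong (suc n) (λ i _ → pascal i)) ⟩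
  h 0 + ∑< (suc n) (λ i → + (suc n C suc i) * F (suc i) (n ∸ i)) ∎
  where
  c g h : ℕ → ℤ
  c i = + (n C i)
  g i = c i * F (suc i) (n ∸ i)
  h i = c i * F i (suc n ∸ i)
  last≡0 : h (suc n) ≡ 0ℤ
  last≡0 = trans (cong (λ z → + z * F (suc n) (n ∸ n)) (k>n⇒nCk≡0 {n} {suc n} (ℕ.n<1+n n)))
    (ℤ.*-zeroˡ (F (suc n) (n ∸ n)))
  swap : ∀ x y z → x + (y + z) ≡ y + (x + z)
  swap = solve-∀
  pascal : ∀ i → g i + h (suc i) ≡ + (suc n C suc i) * F (suc i) (n ∸ i)
  pascal i = trans (sym (ℤ.*-distribʳ-+ (F (suc i) (n ∸ i)) (c i) (c (suc i))))
    (cong (λ z → + z * F (suc i) (n ∸ i)) (nCk+nC[k+1]≡[n+1]C[k+1] n i))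

-- Common source of the binomial theorem and Newton's formula: each unfolding of `n` sends one unit
-- to `i` or to `l`. The induction shifts Φ in `n`, and `binomialSum-suc` absorbs the one step that
-- remains.
pascal-expansion : ∀ (Φ : ℕ → ℕ → ℕ → ℤ) →
  (∀ n i l → Φ (suc n) i l ≡ Φ n (suc i) l + Φ n i (suc l)) →
  ∀ n → Φ n 0 0 ≡ binomialSum n (Φ 0)
pascal-expansion Φ step zero    = sym (trans (ℤ.+-identityʳ _) (ℤ.*-identityˡ _))
pascal-expansion Φ step (suc n) = begin
  Φ (suc n) 0 0
    ≡⟨ pascal-expansion (Φ ∘ suc) (step ∘ suc) n ⟩
  binomialSum n (Φ 1)
    ≡⟨ ∑<-cong (suc n) (λ i _ → cong (+ (n C i) *_) (step 0 i (n ∸ i))) ⟩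
  binomialSum n (λ i l → Φ 0 (suc i) l + Φ 0 i (suc l))
    ≡⟨ binomialSum-suc n (Φ 0) ⟩
  binomialSum (suc n) (Φ 0) ∎

binomial-theorem : ∀ y x n →
  (y + x) ^ n ≡ ∑< (suc n) (λ i → + (n C i) * (y ^ i * x ^ (n ∸ i)))
binomial-theorem y x n = trans (sym (ℤ.*-identityʳ _))
  -- The factors yⁱ xˡ record the choices made so far; at n = 0 only they remain.
  (trans (pascal-expansion (λ n i l → (y + x) ^ n * (y ^ i * x ^ l))
    (λ n i l → step y x ((y + x) ^ n) (y ^ i) (x ^ l)) n)
    (∑<-cong (suc n) (λ i _ → cong (+ (n C i) *_) (ℤ.*-identityˡ (y ^ i * x ^ (n ∸ i))))))
  where
  step : ∀ y x p q r → (y + x) * p * (q * r) ≡ p * (y * q * r) + p * (q * (x * r))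
  step = solve-∀

Δ^ : ℕ → (ℕ → ℤ) → ℕ → ℤ
Δ^ zero    f a = f a
Δ^ (suc i) f a = Δ^ i f (suc a) - Δ^ i f a

newton-forward : ∀ f a n →
  f (a ℕ.+ n) ≡ ∑< (suc n) (λ i → + (n C i) * Δ^ i f a)
newton-forward f a n = trans
  (pascal-expansion (λ n i _ → Δ^ i f (a ℕ.+ n)) (λ n i _ → step n i) n)
  (∑<-cong (suc n) (λ i _ → cong (λ z → + (n C i) * Δ^ i f z) (ℕ.+-identityʳ a)))
  where
  cancel : ∀ x y → x ≡ x - y + y
  cancel = solve-∀
  step : ∀ n i → Δ^ i f (a ℕ.+ suc n) ≡ Δ^ (suc i) f (a ℕ.+ n) + Δ^ i f (a ℕ.+ n)
  step n i = trans (cong (Δ^ i f) (ℕ.+-suc a n)) (cancel (Δ^ i f (suc a ℕ.+ n)) (Δ^ i f (a ℕ.+ n)))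

∣-∑< : ∀ {d} n g → (∀ i → i < n → d ∣ℤ g i) → d ∣ℤ ∑< n g
∣-∑< zero    g d∣g = divides 0ℤ refl
∣-∑< (suc n) g d∣g =
  ∣m∣n⇒∣m+n (d∣g 0 (s≤s z≤n)) (∣-∑< n (g ∘ suc) (λ i i<n → d∣g (suc i) (s≤s i<n)))

2*suc : ∀ h → 2 ℕ.* suc h ≡ suc (suc (2 ℕ.* h))
2*suc h = cong suc (ℕ.+-suc h (h ℕ.+ 0))

-- The sign doubles the even-indexed terms and cancels the odd ones; the induction peels off two
-- terms at a time.
∑<-even : ∀ h g → ∑< (suc (2 ℕ.* h)) (λ i → g i + -1ℤ ^ i * g i)
  ≡ + 2 * (g 0 + ∑< h (λ j → g (2 ℕ.* suc j)))
∑<-even zero    g = lemma (g 0)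
  where
  lemma : ∀ x → x + 1ℤ * x + 0ℤ ≡ + 2 * (x + 0ℤ)
  lemma = solve-∀
∑<-even (suc h) g = begin
  ∑< (suc (2 ℕ.* suc h)) (λ i → g i + -1ℤ ^ i * g i)
    ≡⟨ cong (λ n → ∑< (suc n) (λ i → g i + -1ℤ ^ i * g i)) (2*suc h) ⟩
  g 0 + 1ℤ * g 0 + (g 1 + -1ℤ * 1ℤ * g 1 + ∑< n (λ i → g (2 ℕ.+ i) + -1ℤ * (-1ℤ * -1ℤ ^ i) * g (2 ℕ.+ i)))
    ≡⟨ cong (λ z → g 0 + 1ℤ * g 0 + (g 1 + -1ℤ * 1ℤ * g 1 + z)) (∑<-cong n (λ i _ → signs (-1ℤ ^ i) (g (2 ℕ.+ i)))) ⟩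
  g 0 + 1ℤ * g 0 + (g 1 + -1ℤ * 1ℤ * g 1 + ∑< n (λ i → g (2 ℕ.+ i) + -1ℤ ^ i * g (2 ℕ.+ i)))
    ≡⟨ cong (λ z → g 0 + 1ℤ * g 0 + (g 1 + -1ℤ * 1ℤ * g 1 + z)) (∑<-even h (λ i → g (2 ℕ.+ i))) ⟩
  g 0 + 1ℤ * g 0 + (g 1 + -1ℤ * 1ℤ * g 1 + + 2 * (g 2 + ∑< h (λ j → g (2 ℕ.+ 2 ℕ.* suc j))))
    ≡⟨ collect (g 0) (g 1) (g 2 + ∑< h (λ j → g (2 ℕ.+ 2 ℕ.* suc j))) ⟩
  + 2 * (g 0 + (g 2 + ∑< h (λ j → g (2 ℕ.+ 2 ℕ.* suc j))))
    ≡⟨ cong (λ z → + 2 * (g 0 + (g 2 + z))) (∑<-cong h (λ j _ → cong g (sym (2*suc (suc j))))) ⟩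
  + 2 * (g 0 + (g 2 + ∑< h (λ j → g (2 ℕ.* suc (suc j))))) ∎
  where
  n = suc (2 ℕ.* h)
  signs : ∀ e x → x + -1ℤ * (-1ℤ * e) * x ≡ x + e * x
  signs = solve-∀
  collect : ∀ x y z → x + 1ℤ * x + (y + -1ℤ * 1ℤ * y + + 2 * z) ≡ + 2 * (x + z)
  collect = solve-∀

-- The symmetric shift x ± 1 produces the binomial coefficients at even positions that occur in the
-- recurrence of `U`.
even-binomial : ∀ x h → (1ℤ + x) ^ (2 ℕ.* h) + (-1ℤ + x) ^ (2 ℕ.* h)
  ≡ + 2 * (x ^ (2 ℕ.* h) + ∑< h (λ t → + (2 ℕ.* h C (2 ℕ.* suc t)) * x ^ (2 ℕ.* h ∸ 2 ℕ.* suc t)))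
even-binomial x h = begin
  (1ℤ + x) ^ n + (-1ℤ + x) ^ n
    ≡⟨ cong₂ _+_ (binomial-theorem 1ℤ x n) (binomial-theorem -1ℤ x n) ⟩
  ∑< (suc n) (λ i → c i * (1ℤ ^ i * x ^ (n ∸ i))) + ∑< (suc n) (λ i → c i * (-1ℤ ^ i * x ^ (n ∸ i)))
    ≡⟨ ∑<-+ (suc n) (λ i → c i * (1ℤ ^ i * x ^ (n ∸ i))) (λ i → c i * (-1ℤ ^ i * x ^ (n ∸ i))) ⟨
  ∑< (suc n) (λ i → c i * (1ℤ ^ i * x ^ (n ∸ i)) + c i * (-1ℤ ^ i * x ^ (n ∸ i)))
    ≡⟨ ∑<-cong (suc n) (λ i _ → trans
         (cong (λ z → c i * (z * x ^ (n ∸ i)) + c i * (-1ℤ ^ i * x ^ (n ∸ i))) (ℤ.^-zeroˡ i))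
         (factor (c i) (x ^ (n ∸ i)) (-1ℤ ^ i))) ⟩
  ∑< (suc n) (λ i → c i * x ^ (n ∸ i) + -1ℤ ^ i * (c i * x ^ (n ∸ i)))
    ≡⟨ ∑<-even h (λ i → c i * x ^ (n ∸ i)) ⟩
  + 2 * (c 0 * x ^ n + ∑< h (λ t → c (2 ℕ.* suc t) * x ^ (n ∸ 2 ℕ.* suc t)))
    ≡⟨ cong (λ z → + 2 * (z + ∑< h (λ t → c (2 ℕ.* suc t) * x ^ (n ∸ 2 ℕ.* suc t)))) (ℤ.*-identityˡ (x ^ n)) ⟩
  + 2 * (x ^ n + ∑< h (λ t → c (2 ℕ.* suc t) * x ^ (n ∸ 2 ℕ.* suc t))) ∎
  where
  n = 2 ℕ.* h
  c : ℕ → ℤ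
  c i = + (n C i)
  factor : ∀ c y e → c * (1ℤ * y) + c * (e * y) ≡ c * y + e * (c * y)
  factor = solve-∀

U-even-suc : ∀ h → let n = 2 ℕ.* suc h in
  U n ≡ - (+ 2) * ∑< (suc h) (λ t → + (n C (2 ℕ.* suc t)) * U (n ∸ 2 ℕ.* suc t))
U-even-suc h = trans (U-suc (h ℕ.+ suc (h ℕ.+ 0)))
  (cong (λ k → - (+ 2) * ∑< k (λ t → + (n C (2 ℕ.* suc t)) * U (n ∸ 2 ℕ.* suc t))) half)
  where
  n = 2 ℕ.* suc h
  half : ⌊ n /2⌋ ≡ suc h
  half = trans (cong (λ k → ⌊ suc h ℕ.+ k /2⌋) (ℕ.+-identityʳ (suc h))) (sym (ℕ.n≡⌊n+n/2⌋ (suc h)))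

-- Alternating power sums and U

s : ℕ → ℤ
s 0             = 0ℤ
s 1             = 1ℤ
s (suc (suc j)) = s (suc j) - s j

S : ℕ → ℕ → ℤ
S n L = ∑< L (λ j → s j * (+ j) ^ n)

-- Summation by parts: away from the ends, jⁿ gets the coefficient s (j - 1) + s (j + 1) - s j = 0,
-- so only boundary terms are left.
S-telescope : ∀ n L →
  ∑< (suc L) (λ j → s j * ((1ℤ + + j) ^ n + (-1ℤ + + j) ^ n - (+ j) ^ n))
    ≡ 0ℤ ^ n + s L * (+ suc L) ^ n - s (suc L) * (+ L) ^ n
S-telescope n zero    = base ((1ℤ + 0ℤ) ^ n) ((-1ℤ + 0ℤ) ^ n) (0ℤ ^ n) 
  where
  base : ∀ x y z → 0ℤ * (x + y - z) + 0ℤ ≡ z + 0ℤ * x - 1ℤ * z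
  base = solve-∀
S-telescope n (suc L) = trans (∑<-suc (suc L) g)
  (trans (cong (_+ g (suc L)) (S-telescope n L))
    (step (0ℤ ^ n) (s L) (s (suc L)) ((+ suc L) ^ n) ((+ L) ^ n) ((+ suc (suc L)) ^ n)))
  where
  g : ℕ → ℤ
  g j = s j * ((1ℤ + + j) ^ n + (-1ℤ + + j) ^ n - (+ j) ^ n)
  step : ∀ z a b x y w → z + a * x - b * y + b * (w + y - x) ≡ z + b * w - (b - a) * x
  step = solve-∀

-- The boundary values reduce the telescoped sum to 0ⁿ + Nⁿ with N = `suc L`, and `even-binomial`
-- rewrites the other side. For n > 0 this is the recurrence of `U` up to the term Nⁿ.
S-recurrence : ∀ h L → s L ≡ 1ℤ → s (suc L) ≡ 0ℤ → let n = 2 ℕ.* h in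
  S n (suc L) ≡ 0ℤ ^ n + (+ suc L) ^ n
    - + 2 * ∑< h (λ t → + (n C (2 ℕ.* suc t)) * S (n ∸ 2 ℕ.* suc t) (suc L))
S-recurrence h L sL≡1 s1+L≡0 = begin
  S n (suc L)
    ≡⟨ isolate (S n (suc L)) Σ ⟩
  S n (suc L) + + 2 * Σ - + 2 * Σ
    ≡⟨ cong (_- + 2 * Σ) main ⟩
  0ℤ ^ n + (+ suc L) ^ n - + 2 * Σ ∎
  where
  n = 2 ℕ.* h
  c : ℕ → ℤ
  c t = + (n C (2 ℕ.* suc t))
  e : ℕ → ℕ
  e t = n ∸ 2 ℕ.* suc t
  Σ = ∑< h (λ t → c t * S (e t) (suc L))
  isolate : ∀ x y → x ≡ x + + 2 * y - + 2 * y
  isolate = solve-∀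
  exchange : ∑< (suc L) (λ j → s j * ∑< h (λ t → c t * (+ j) ^ e t)) ≡ Σ
  exchange = begin
    ∑< (suc L) (λ j → s j * ∑< h (λ t → c t * (+ j) ^ e t))
      ≡⟨ ∑<-cong (suc L) (λ j _ → ∑<-*ˡ h (s j) (λ t → c t * (+ j) ^ e t)) ⟨
    ∑< (suc L) (λ j → ∑< h (λ t → s j * (c t * (+ j) ^ e t)))
      ≡⟨ ∑<-comm (suc L) h (λ j t → s j * (c t * (+ j) ^ e t)) ⟩
    ∑< h (λ t → ∑< (suc L) (λ j → s j * (c t * (+ j) ^ e t)))
      ≡⟨ ∑<-cong h (λ t _ → trans (∑<-cong (suc L) (λ j _ → left-comm (s j) (c t) ((+ j) ^ e t)))
           (∑<-*ˡ (suc L) (c t) (λ j → s j * (+ j) ^ e t))) ⟩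
    Σ ∎
    where
    left-comm : ∀ x y z → x * (y * z) ≡ y * (x * z)
    left-comm = solve-∀
  main : S n (suc L) + + 2 * Σ ≡ 0ℤ ^ n + (+ suc L) ^ n
  main = begin
    S n (suc L) + + 2 * Σ
      ≡⟨ cong (λ z → S n (suc L) + + 2 * z) exchange ⟨
    S n (suc L) + + 2 * ∑< (suc L) (λ j → s j * ∑< h (λ t → c t * (+ j) ^ e t))
      ≡⟨ cong (λ z → S n (suc L) + z) (∑<-*ˡ (suc L) (+ 2) (λ j → s j * ∑< h (λ t → c t * (+ j) ^ e t))) ⟨
    S n (suc L) + ∑< (suc L) (λ j → + 2 * (s j * ∑< h (λ t → c t * (+ j) ^ e t)))
      ≡⟨ ∑<-+ (suc L) (λ j → s j * (+ j) ^ n) (λ j → + 2 * (s j * ∑< h (λ t → c t * (+ j) ^ e t))) ⟨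
    ∑< (suc L) (λ j → s j * (+ j) ^ n + + 2 * (s j * ∑< h (λ t → c t * (+ j) ^ e t)))
      ≡⟨ ∑<-cong (suc L) (λ j _ → trans (arrange (s j) ((+ j) ^ n) (∑< h (λ t → c t * (+ j) ^ e t)))
           (cong (λ z → s j * (z - (+ j) ^ n)) (sym (even-binomial (+ j) h)))) ⟩
    ∑< (suc L) (λ j → s j * ((1ℤ + + j) ^ n + (-1ℤ + + j) ^ n - (+ j) ^ n))
      ≡⟨ S-telescope n L ⟩
    0ℤ ^ n + s L * (+ suc L) ^ n - s (suc L) * (+ L) ^ n
      ≡⟨ cong₂ (λ x y → 0ℤ ^ n + x * (+ suc L) ^ n - y * (+ L) ^ n) sL≡1 s1+L≡0 ⟩
    0ℤ ^ n + 1ℤ * (+ suc L) ^ n - 0ℤ * (+ L) ^ n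
      ≡⟨ drop (0ℤ ^ n) ((+ suc L) ^ n) ((+ L) ^ n) ⟩
    0ℤ ^ n + (+ suc L) ^ n ∎
    where
    arrange : ∀ s x y → s * x + + 2 * (s * y) ≡ s * (+ 2 * (x + y) - x)
    arrange = solve-∀
    drop : ∀ x y z → x + 1ℤ * y - 0ℤ * z ≡ x + y
    drop = solve-∀

-- Strong induction: at h = 0 the boundary terms 0⁰ + N⁰ equal 2 = 2 U 0, where N = `suc L`, and for
-- h > 0 the term Nⁿ vanishes modulo d.
S≡2U : ∀ {d} L → s L ≡ 1ℤ → s (suc L) ≡ 0ℤ → d ∣ℤ + suc L →
  ∀ h → d ∣ℤ S (2 ℕ.* h) (suc L) - + 2 * U (2 ℕ.* h)
S≡2U {d} L sL≡1 s1+L≡0 d∣1+L = <-rec P step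
  where
  P : ℕ → Set
  P h = d ∣ℤ S (2 ℕ.* h) (suc L) - + 2 * U (2 ℕ.* h)
  step : ∀ h → (∀ {k} → k < h → P k) → P h
  step zero    _   = subst (λ z → d ∣ℤ z - + 2 * U 0) (sym (S-recurrence 0 L sL≡1 s1+L≡0)) (divides 0ℤ refl)
  step (suc h) rec = subst (d ∣ℤ_) (sym difference)
    (∣m∣n⇒∣m-n (∣m⇒∣m*n ((+ suc L) ^ (h ℕ.+ suc (h ℕ.+ 0))) d∣1+L)
      (∣n⇒∣m*n (+ 2) (∣-∑< (suc h) (λ t → c t * (S (e t) (suc L) - + 2 * U (e t))) λ t _ → ∣n⇒∣m*n (c t)
       (subst (λ k → d ∣ℤ S k (suc L) - + 2 * U k) (ℕ.*-distribˡ-∸ 2 (suc h) (suc t))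
         (rec {h ∸ t} (s≤s (ℕ.m∸n≤m h t)))))))
    where
    n = 2 ℕ.* suc h
    c : ℕ → ℤ
    c t = + (n C (2 ℕ.* suc t))
    e : ℕ → ℕ
    e t = n ∸ 2 ℕ.* suc t
    linear : ∀ p x y → 0ℤ + p - + 2 * x - + 2 * (- (+ 2) * y) ≡ p - + 2 * (x + - (+ 2) * y)
    linear = solve-∀
    distrib : ∀ c x y → c * x + - (+ 2) * (c * y) ≡ c * (x - + 2 * y)
    distrib = solve-∀
    X = ∑< (suc h) (λ t → c t * S (e t) (suc L))
    Y = ∑< (suc h) (λ t → c t * U (e t))
    difference : S n (suc L) - + 2 * U n
      ≡ (+ suc L) ^ n - + 2 * ∑< (suc h) (λ t → c t * (S (e t) (suc L) - + 2 * U (e t)))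
    difference = begin
      S n (suc L) - + 2 * U n
        ≡⟨ cong₂ (λ x y → x - + 2 * y) (S-recurrence (suc h) L sL≡1 s1+L≡0) (U-even-suc h) ⟩
      0ℤ + (+ suc L) ^ n - + 2 * X - + 2 * (- (+ 2) * Y)
        ≡⟨ linear ((+ suc L) ^ n) X Y ⟩
      (+ suc L) ^ n - + 2 * (X + - (+ 2) * Y)
        ≡⟨ cong (λ z → (+ suc L) ^ n - + 2 * (X + z)) (∑<-*ˡ (suc h) (- (+ 2)) (λ t → c t * U (e t))) ⟨
      (+ suc L) ^ n - + 2 * (X + ∑< (suc h) (λ t → - (+ 2) * (c t * U (e t))))
        ≡⟨ cong (λ z → (+ suc L) ^ n - + 2 * z) (∑<-+ (suc h) (λ t → c t * S (e t) (suc L)) (λ t → - (+ 2) * (c t * U (e t)))) ⟨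
      (+ suc L) ^ n - + 2 * ∑< (suc h) (λ t → c t * S (e t) (suc L) + - (+ 2) * (c t * U (e t)))
        ≡⟨ cong (λ z → (+ suc L) ^ n - + 2 * z) (∑<-cong (suc h) (λ t _ → distrib (c t) (S (e t) (suc L)) (U (e t)))) ⟩
      (+ suc L) ^ n - + 2 * ∑< (suc h) (λ t → c t * (S (e t) (suc L) - + 2 * U (e t))) ∎

-- Tabulation of U at even arguments

dot : ∀ {k} → (ℕ → ℤ) → Vec ℤ k → ℤ
dot c []       = 0ℤ
dot c (x ∷ xs) = c 0 * x + dot (λ j → c (suc j)) xs

-- The values U (2 h), …, U 2, U 0; evaluating U directly would take exponential time.
evenTable : ∀ h → Vec ℤ (suc h)
evenTable zero    = 1ℤ ∷ []
evenTable (suc h) = grow (evenTable h)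
  where
  grow : Vec ℤ (suc h) → Vec ℤ (suc (suc h))
  grow us = - (+ 2) * dot (λ t → + (2 ℕ.* suc h C (2 ℕ.* suc t))) us ∷ us

mutual
  dot-evenTable : ∀ h c → dot c (evenTable h) ≡ ∑< (suc h) (λ j → c j * U (2 ℕ.* (h ∸ j)))
  dot-evenTable zero    c = refl
  dot-evenTable (suc h) c = cong₂ (λ u z → c 0 * u + z) (sym (U-evenTable (suc h))) (dot-evenTable h (λ j → c (suc j)))

  U-evenTable : ∀ h → U (2 ℕ.* h) ≡ Vec.head (evenTable h)
  U-evenTable zero    = refl
  U-evenTable (suc h) = trans (U-even-suc h) (cong (- (+ 2) *_) (trans
    (∑<-cong (suc h) λ t _ → cong (λ n → + (2 ℕ.* suc h C (2 ℕ.* suc t)) * U n) (sym (ℕ.*-distribˡ-∸ 2 (suc h) (suc t))))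
    (sym (dot-evenTable h (λ t → + (2 ℕ.* suc h C (2 ℕ.* suc t)))))))

-- Powers of 5

5-prime : Prime 5
5-prime = from-yes (prime? 5)

-- Euclid's lemma extracts one factor p from c at a time.
prime-power-cancelˡ : ∀ {p u} → Prime p → ¬ p ∣ u → ∀ n c → p ℕ.^ n ∣ u ℕ.* c → p ℕ.^ n ∣ c
prime-power-cancelˡ         pp p∤u zero    c _       = ℕ.1∣ c
prime-power-cancelˡ {p} {u} pp p∤u (suc n) c pⁿ⁺¹∣uc
  with euclidsLemma u c pp (ℕ.∣-trans (ℕ.m∣m*n (p ℕ.^ n)) pⁿ⁺¹∣uc)
... | inj₁ p∣u = contradiction p∣u p∤u
... | inj₂ (ℕ.divides c′ refl) = subst (p ℕ.^ suc n ∣_) (ℕ.*-comm p c′)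
  (ℕ.*-monoʳ-∣ p (prime-power-cancelˡ pp p∤u n c′
    (ℕ.*-cancelˡ-∣ p {{prime⇒nonZero pp}} (subst (p ℕ.^ suc n ∣_) rearrange pⁿ⁺¹∣uc))))
  where
  rearrange : u ℕ.* (c′ ℕ.* p) ≡ p ℕ.* (u ℕ.* c′)
  rearrange = trans (sym (ℕ.*-assoc u c′ p)) (ℕ.*-comm (u ℕ.* c′) p)

pos-^ : ∀ m n → + (m ℕ.^ n) ≡ (+ m) ^ n
pos-^ m zero    = refl
pos-^ m (suc n) = trans (pos-* m (m ℕ.^ n)) (cong (+ m *_) (pos-^ m n))

^-distribʳ-* : ∀ x y n → (x * y) ^ n ≡ x ^ n * y ^ n
^-distribʳ-* x y zero    = refl
^-distribʳ-* x y (suc n) = trans (cong (x * y *_) (^-distribʳ-* x y n)) (interchange x y (x ^ n) (y ^ n))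
  where
  interchange : ∀ a b c d → a * b * (c * d) ≡ a * c * (b * d)
  interchange = solve-∀

5^-cancelˡ : ∀ u → ¬ 5 ∣ u → ∀ n {x} → (+ 5) ^ n ∣ℤ + u * x → (+ 5) ^ n ∣ℤ x
5^-cancelˡ u 5∤u n {x} 5ⁿ∣ux rewrite sym (pos-^ 5 n) =
  ∣ᵤ⇒∣ (prime-power-cancelˡ 5-prime 5∤u n ℤ.∣ x ∣
    (subst (5 ℕ.^ n ∣_) (ℤ.abs-* (+ u) x) (∣⇒∣ᵤ 5ⁿ∣ux)))

-- Since 5 ≡ -1 modulo the period 6 and s extends to an odd function, s (5 i) = s (-i) = - s i. The
-- second equation carries the two-term recurrence through the induction.
s-5* : ∀ i → s (i ℕ.* 5) ≡ - s i × s (1 ℕ.+ i ℕ.* 5) ≡ s (suc i) - s i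
s-5* zero = refl , refl
s-5* (suc i) with p , q ← s-5* i =
    -- With a = s (5 i) and b = s (5 i + 1), this is the recurrence unrolled up to s (5 i + 5).
    trans (cong₂ (λ a b → b - a - b - (b - a) - (b - a - b)) p q) (fifth (s i) (s (suc i)))
  , trans (cong₂ (λ a b → b - a - b - (b - a) - (b - a - b) - (b - a - b - (b - a))) p q) (sixth (s i) (s (suc i)))
  where
  fifth : ∀ a b → let x = - a ; y = b - a in y - x - y - (y - x) - (y - x - y) ≡ - b
  fifth = solve-∀
  sixth : ∀ a b → let x = - a ; y = b - a in
    y - x - y - (y - x) - (y - x - y) - (y - x - y - (y - x)) ≡ b - a - b
  sixth = solve-∀

-- The two equations on L say that `suc L` is an odd multiple of 3, a property kept when `suc L` is
-- multiplied by 5.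
antiperiod-5* : ∀ L → s L ≡ 1ℤ → s (suc L) ≡ 0ℤ →
  s (4 ℕ.+ L ℕ.* 5) ≡ 1ℤ × s (5 ℕ.+ L ℕ.* 5) ≡ 0ℤ
antiperiod-5* L sL≡1 s1+L≡0 =
    trans (cong₂ (λ a b → b - a - b - (b - a)) (proj₁ (s-5* L)) (proj₂ (s-5* L)))
      (cong₂ (λ a b → b - a - - a - (b - a) - (b - a - - a)) sL≡1 s1+L≡0)
  , trans (proj₁ (s-5* (suc L))) (cong -_ s1+L≡0)

-- The witness is L = 3 · 5ᴹ - 1.
antiperiod : ∀ M → ∃[ L ] s L ≡ 1ℤ × s (suc L) ≡ 0ℤ × (+ 5) ^ M ∣ℤ + suc L
antiperiod zero = 2 , refl , refl , divides (+ 3) refl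
antiperiod (suc M) with L , sL , s1+L , divides q eq ← antiperiod M =
    4 ℕ.+ L ℕ.* 5
  , proj₁ (antiperiod-5* L sL s1+L)
  , proj₂ (antiperiod-5* L sL s1+L)
  , divides q (trans (pos-* (suc L) 5) (trans (cong (_* + 5) eq) (swap q ((+ 5) ^ M))))
  where
  swap : ∀ q x → q * x * + 5 ≡ q * (+ 5 * x)
  swap = solve-∀

∑<-*5 : ∀ L g → ∑< (L ℕ.* 5) g ≡
  ∑< L (λ i → g (i ℕ.* 5) + (g (1 ℕ.+ i ℕ.* 5) + (g (2 ℕ.+ i ℕ.* 5) + (g (3 ℕ.+ i ℕ.* 5) + g (4 ℕ.+ i ℕ.* 5)))))
∑<-*5 zero    g = refl
∑<-*5 (suc L) g = trans (cong (λ z → g 0 + (g 1 + (g 2 + (g 3 + (g 4 + z))))) (∑<-*5 L (λ i → g (5 ℕ.+ i))))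
  (assoc (g 0) (g 1) (g 2) (g 3) (g 4) (∑< L (λ i → g (5 ℕ.+ i ℕ.* 5)
    + (g (6 ℕ.+ i ℕ.* 5) + (g (7 ℕ.+ i ℕ.* 5) + (g (8 ℕ.+ i ℕ.* 5) + g (9 ℕ.+ i ℕ.* 5)))))))
  where
  assoc : ∀ a b c d e z → a + (b + (c + (d + (e + z)))) ≡ a + (b + (c + (d + e))) + z
  assoc = solve-∀

-- The terms of the block 5 i, ..., 5 i + 4 whose index is prime to 5.
unitPart : ℕ → ℕ → ℤ
unitPart n i = g 1 + (g 2 + (g 3 + g 4))
  where
  g : ℕ → ℤ
  g c = s (c ℕ.+ i ℕ.* 5) * (+ (c ℕ.+ i ℕ.* 5)) ^ n

-- By s (5 i) = - s i, the terms at multiples of 5 sum to -5ⁿ S n L. The factor 1 + 5ⁿ arises here,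
-- once both sums are replaced by 2 U n.
S-5* : ∀ n L → S n (L ℕ.* 5) + (+ 5) ^ n * S n L ≡ ∑< L (unitPart n)
S-5* n L = begin
  S n (L ℕ.* 5) + (+ 5) ^ n * S n L
    ≡⟨ cong₂ _+_ (∑<-*5 L (λ j → s j * (+ j) ^ n)) (sym (∑<-*ˡ L ((+ 5) ^ n) (λ j → s j * (+ j) ^ n))) ⟩
  ∑< L (λ i → s (i ℕ.* 5) * (+ (i ℕ.* 5)) ^ n + unitPart n i) + ∑< L (λ i → (+ 5) ^ n * (s i * (+ i) ^ n))
    ≡⟨ ∑<-+ L (λ i → s (i ℕ.* 5) * (+ (i ℕ.* 5)) ^ n + unitPart n i) (λ i → (+ 5) ^ n * (s i * (+ i) ^ n)) ⟨
  ∑< L (λ i → s (i ℕ.* 5) * (+ (i ℕ.* 5)) ^ n + unitPart n i + (+ 5) ^ n * (s i * (+ i) ^ n))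
    ≡⟨ ∑<-cong L (λ i _ → trans
         (cong₂ (λ a b → a * b + unitPart n i + (+ 5) ^ n * (s i * (+ i) ^ n)) (proj₁ (s-5* i))
           (trans (cong (_^ n) (pos-* i 5)) (^-distribʳ-* (+ i) (+ 5) n)))
         (cancel (s i) ((+ i) ^ n) ((+ 5) ^ n) (unitPart n i))) ⟩
  ∑< L (unitPart n) ∎
  where
  cancel : ∀ s x y z → - s * (x * y) + z + y * (s * x) ≡ z
  cancel = solve-∀

-- Rules for iterated differences

Δ^-+ : ∀ f g i a → Δ^ i (λ a → f a + g a) a ≡ Δ^ i f a + Δ^ i g a
Δ^-+ f g zero    a = refl
Δ^-+ f g (suc i) a = trans (cong₂ _-_ (Δ^-+ f g i (suc a)) (Δ^-+ f g i a))
  (interchange (Δ^ i f (suc a)) (Δ^ i g (suc a)) (Δ^ i f a) (Δ^ i g a))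
  where
  interchange : ∀ w x y z → w + x - (y + z) ≡ w - y + (x - z)
  interchange = solve-∀

Δ^-* : ∀ c f i a → Δ^ i (λ a → c * f a) a ≡ c * Δ^ i f a
Δ^-* c f zero    a = refl
Δ^-* c f (suc i) a = trans (cong₂ _-_ (Δ^-* c f i (suc a)) (Δ^-* c f i a))
  (factor c (Δ^ i f (suc a)) (Δ^ i f a))
  where
  factor : ∀ c x y → c * x - c * y ≡ c * (x - y)
  factor = solve-∀

Δ^-cong : ∀ {f g} → f ≗ g → ∀ i → Δ^ i f ≗ Δ^ i g
Δ^-cong f≗g zero    a = f≗g a
Δ^-cong f≗g (suc i) a = cong₂ _-_ (Δ^-cong f≗g i (suc a)) (Δ^-cong f≗g i a)

Δ^-∣ : ∀ {d f} → (∀ a → d ∣ℤ f a) → ∀ i a → d ∣ℤ Δ^ i f a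
Δ^-∣ d∣f zero    a = d∣f a
Δ^-∣ d∣f (suc i) a = ∣m∣n⇒∣m-n (Δ^-∣ d∣f i (suc a)) (Δ^-∣ d∣f i a)

-- Kummer congruences

Kummer : (ℕ → ℤ) → Set
Kummer f = ∀ i a → (+ 5) ^ i ∣ℤ Δ^ i f a

Kummer-cong : ∀ {f g} → f ≗ g → Kummer f → Kummer g
Kummer-cong f≗g kf i a = subst (_ ∣ℤ_) (Δ^-cong f≗g i a) (kf i a)

Kummer-+ : ∀ {f g} → Kummer f → Kummer g → Kummer (λ a → f a + g a)
Kummer-+ {f} {g} kf kg i a = subst ((+ 5) ^ i ∣ℤ_) (sym (Δ^-+ f g i a)) (∣m∣n⇒∣m+n (kf i a) (kg i a))

Kummer-∑< : ∀ n (f : ℕ → ℕ → ℤ) → (∀ j → Kummer (f j)) → Kummer (λ a → ∑< n (λ j → f j a))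
Kummer-∑< zero    f kf i a = Δ^-∣ (λ _ → divides 0ℤ refl) i a
Kummer-∑< (suc n) f kf     = Kummer-+ {f 0} (kf 0) (Kummer-∑< n (f ∘ suc) (kf ∘ suc))

Δ^-geometric : ∀ c y i a → Δ^ i (λ a → c * y ^ a) a ≡ (y - 1ℤ) ^ i * (c * y ^ a)
Δ^-geometric c y zero    a = sym (ℤ.*-identityˡ _)
Δ^-geometric c y (suc i) a = trans (cong₂ _-_ (Δ^-geometric c y i (suc a)) (Δ^-geometric c y i a))
  (factor y c ((y - 1ℤ) ^ i) (y ^ a))
  where
  factor : ∀ y c p q → p * (c * (y * q)) - p * (c * q) ≡ (y - 1ℤ) * p * (c * q)
  factor = solve-∀

^-mono-∣ : ∀ {d x} → d ∣ℤ x → ∀ n → d ^ n ∣ℤ x ^ n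
^-mono-∣ {d} (divides q refl) n = divides (q ^ n) (^-distribʳ-* q d n)

Kummer-geometric : ∀ c y → + 5 ∣ℤ y - 1ℤ → Kummer (λ a → c * y ^ a)
Kummer-geometric c y 5∣y-1 i a = subst ((+ 5) ^ i ∣ℤ_) (sym (Δ^-geometric c y i a))
  (∣m⇒∣m*n (c * y ^ a) (^-mono-∣ 5∣y-1 i))

-- For a given i, an approximation of 2 f modulo 5ⁱ already decides the claim, because 2 is a unit
-- modulo 5.
Kummer-lim : ∀ f → (∀ M → ∃[ g ] Kummer g × (∀ a → (+ 5) ^ M ∣ℤ g a - + 2 * f a)) → Kummer f
Kummer-lim f approx i a with g , kg , g≡2f ← approx i =
  5^-cancelˡ 2 (from-no (5 ∣? 2)) i (subst ((+ 5) ^ i ∣ℤ_) difference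
    (∣m∣n⇒∣m-n (kg i a) (Δ^-∣ g≡2f i a)))
  where
  cancel : ∀ x y → x - (x + - (+ 2) * y) ≡ + 2 * y
  cancel = solve-∀
  neg : ∀ x y → x - + 2 * y ≡ x + - (+ 2) * y
  neg = solve-∀
  difference : Δ^ i g a - Δ^ i (λ a → g a - + 2 * f a) a ≡ + 2 * Δ^ i f a
  difference = begin
    Δ^ i g a - Δ^ i (λ a → g a - + 2 * f a) a
      ≡⟨ cong (λ z → Δ^ i g a - z) (Δ^-cong (λ a → neg (g a) (f a)) i a) ⟩
    Δ^ i g a - Δ^ i (λ a → g a + - (+ 2) * f a) a
      ≡⟨ cong (λ z → Δ^ i g a - z) (Δ^-+ g (λ a → - (+ 2) * f a) i a) ⟩
    Δ^ i g a - (Δ^ i g a + Δ^ i (λ a → - (+ 2) * f a) a)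
      ≡⟨ cong (λ z → Δ^ i g a - (Δ^ i g a + z)) (Δ^-* (- (+ 2)) f i a) ⟩
    Δ^ i g a - (Δ^ i g a + - (+ 2) * Δ^ i f a)
      ≡⟨ cancel (Δ^ i g a) (Δ^ i f a) ⟩
    + 2 * Δ^ i f a ∎

V : ℕ → ℕ → ℤ
V r a = (1ℤ + (+ 5) ^ (r ℕ.+ 4 ℕ.* a)) * U (r ℕ.+ 4 ℕ.* a)

-- An index y prime to 5 has y⁴ ≡ 1 modulo 5, so each term is geometric in a with ratio y⁴.
Kummer-unitPart : ∀ r j → Kummer (λ a → unitPart (r ℕ.+ 4 ℕ.* a) j)
Kummer-unitPart r j =
  -- The quotients 0, 3, 16, 51 are (c⁴ - 1) / 5 for c = 1, 2, 3, 4.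
  Kummer-+ {t 1} (term 1 (divides 0ℤ refl)) (Kummer-+ {t 2} (term 2 (divides (+ 3) refl))
    (Kummer-+ {t 3} (term 3 (divides (+ 16) refl)) (term 4 (divides (+ 51) refl))))
  where
  t : ℕ → ℕ → ℤ
  t c a = s (c ℕ.+ j ℕ.* 5) * (+ (c ℕ.+ j ℕ.* 5)) ^ (r ℕ.+ 4 ℕ.* a)
  expand : ∀ c j → let y = c + j * + 5 in y * (y * (y * (y * 1ℤ))) - 1ℤ ≡
    c * (c * (c * (c * 1ℤ))) - 1ℤ
      + j * (+ 4 * (c * c * c) + + 30 * (c * c * j) + + 100 * (c * j * j) + + 125 * (j * j * j)) * + 5
  expand = solve-∀
  term : ∀ c → + 5 ∣ℤ (+ c) ^ 4 - 1ℤ → Kummer (t c)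
  term c 5∣c⁴-1 = Kummer-cong {λ a → sy * (y ^ 4) ^ a} eq (Kummer-geometric sy (y ^ 4) 5∣y⁴-1)
    where
    y = + (c ℕ.+ j ℕ.* 5)
    sy = s (c ℕ.+ j ℕ.* 5) * y ^ r
    y≡ : y ≡ + c + + j * + 5
    y≡ = cong (_+_ (+ c)) (pos-* j 5)
    5∣y⁴-1 : + 5 ∣ℤ y ^ 4 - 1ℤ
    5∣y⁴-1 = subst (+ 5 ∣ℤ_) (sym (trans (cong (λ z → z ^ 4 - 1ℤ) y≡) (expand (+ c) (+ j))))
      (∣m∣n⇒∣m+n 5∣c⁴-1 (∣n⇒∣m*n
        (+ j * (+ 4 * (+ c * + c * + c) + + 30 * (+ c * + c * + j)
          + + 100 * (+ c * + j * + j) + + 125 * (+ j * + j * + j))) ℤ.∣-refl))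
    eq : ∀ a → sy * (y ^ 4) ^ a ≡ t c a
    eq a = trans (ℤ.*-assoc (s (c ℕ.+ j ℕ.* 5)) (y ^ r) ((y ^ 4) ^ a))
      (cong (s (c ℕ.+ j ℕ.* 5) *_) (trans (cong (y ^ r *_) (ℤ.^-*-assoc y 4 a))
        (sym (ℤ.^-distribˡ-+-* y r (4 ℕ.* a)))))

-- The unit parts sum to S n (5 N) + 5ⁿ S n N, where N = `suc L` is divisible by 5ᴹ. Both sums are ≡
-- 2 U n, so the result approximates 2 V modulo 5ᴹ.
Kummer-V : ∀ h → Kummer (V (2 ℕ.* h))
Kummer-V h = Kummer-lim (V r) approx
  where
  r = 2 ℕ.* h
  even : ∀ a → 2 ℕ.* (h ℕ.+ 2 ℕ.* a) ≡ r ℕ.+ 4 ℕ.* a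
  even a = trans (ℕ.*-distribˡ-+ 2 h (2 ℕ.* a)) (cong (r ℕ.+_) (sym (ℕ.*-assoc 2 2 a)))
  regroup : ∀ x y p u → x - + 2 * u + p * (y - + 2 * u) ≡ x + p * y - + 2 * ((1ℤ + p) * u)
  regroup = solve-∀
  approx : ∀ M → ∃[ g ] Kummer g × (∀ a → (+ 5) ^ M ∣ℤ g a - + 2 * V r a)
  approx M with L , sL , s1+L , 5ᴹ∣1+L ← antiperiod M =
    (λ a → ∑< (suc L) (unitPart (r ℕ.+ 4 ℕ.* a)))
    , Kummer-∑< (suc L) (λ j a → unitPart (r ℕ.+ 4 ℕ.* a) j) (Kummer-unitPart r)
    , λ a → bound (r ℕ.+ 4 ℕ.* a) (h ℕ.+ 2 ℕ.* a) (even a)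
    where
    bound : ∀ n h → 2 ℕ.* h ≡ n → (+ 5) ^ M ∣ℤ ∑< (suc L) (unitPart n) - + 2 * ((1ℤ + (+ 5) ^ n) * U n)
    bound n h refl = subst ((+ 5) ^ M ∣ℤ_)
      (trans (regroup (S n (suc L ℕ.* 5)) (S n (suc L)) ((+ 5) ^ n) (U n))
             (cong (_- + 2 * ((1ℤ + (+ 5) ^ n) * U n)) (S-5* n (suc L))))
      (∣m∣n⇒∣m+n
        (S≡2U (4 ℕ.+ L ℕ.* 5)
          (proj₁ (antiperiod-5* L sL s1+L)) (proj₂ (antiperiod-5* L sL s1+L))
          (subst ((+ 5) ^ M ∣ℤ_) (sym (pos-* (suc L) 5)) (∣m⇒∣m*n (+ 5) 5ᴹ∣1+L)) h)
        (∣n⇒∣m*n ((+ 5) ^ n) (S≡2U L sL s1+L 5ᴹ∣1+L h)))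

-- The logarithm of the shift operator

C-absorption : ∀ n i → suc i ℕ.* (suc n C suc i) ≡ suc n ℕ.* (n C i)
C-absorption zero zero = refl
C-absorption zero (suc i) = trans (cong (suc (suc i) ℕ.*_) (k>n⇒nCk≡0 {1} {suc (suc i)} (s≤s (s≤s z≤n))))
  (trans (ℕ.*-zeroʳ (suc (suc i))) (sym (cong (1 ℕ.*_) (k>n⇒nCk≡0 {0} {suc i} (s≤s z≤n)))))
C-absorption (suc n) zero = trans (ℕ.*-identityˡ _) (trans (nC1≡n (suc (suc n))) (sym (ℕ.*-identityʳ (suc (suc n)))))
C-absorption (suc n) (suc i) = begin
  suc (suc i) ℕ.* (suc (suc n) C suc (suc i))
    ≡⟨ cong (suc (suc i) ℕ.*_) (nCk+nC[k+1]≡[n+1]C[k+1] (suc n) (suc i)) ⟨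
  suc (suc i) ℕ.* ((suc n C suc i) ℕ.+ (suc n C suc (suc i)))
    ≡⟨ expand (suc n C suc i) (suc n C suc (suc i)) i ⟩
  (suc n C suc i) ℕ.+ (suc i ℕ.* (suc n C suc i) ℕ.+ suc (suc i) ℕ.* (suc n C suc (suc i)))
    ≡⟨ cong₂ (λ x y → (suc n C suc i) ℕ.+ (x ℕ.+ y)) (C-absorption n i) (C-absorption n (suc i)) ⟩
  (suc n C suc i) ℕ.+ (suc n ℕ.* (n C i) ℕ.+ suc n ℕ.* (n C suc i))
    ≡⟨ cong ((suc n C suc i) ℕ.+_) (ℕ.*-distribˡ-+ (suc n) (n C i) (n C suc i)) ⟨
  (suc n C suc i) ℕ.+ suc n ℕ.* ((n C i) ℕ.+ (n C suc i))
    ≡⟨ cong (λ x → (suc n C suc i) ℕ.+ suc n ℕ.* x) (nCk+nC[k+1]≡[n+1]C[k+1] n i) ⟩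
  suc (suc n) ℕ.* (suc n C suc i) ∎
  where
  expand : ∀ x y i → suc (suc i) ℕ.* (x ℕ.+ y) ≡ x ℕ.+ (suc i ℕ.* x ℕ.+ suc (suc i) ℕ.* y)
  expand = ℕ-Solver.solve-∀

-- Subtraction-free form of (i + 1) C(n, i + 1) = (n - i) C(n, i), valid also for i > n.
C-falling-step : ∀ n i → suc i ℕ.* (n C suc i) ℕ.+ i ℕ.* (n C i) ≡ n ℕ.* (n C i)
C-falling-step zero zero = refl
C-falling-step zero (suc i) = cong₂ ℕ._+_
  (trans (cong (suc (suc i) ℕ.*_) (k>n⇒nCk≡0 {0} {suc (suc i)} (s≤s z≤n))) (ℕ.*-zeroʳ (suc (suc i))))
  (trans (cong (suc i ℕ.*_) (k>n⇒nCk≡0 {0} {suc i} (s≤s z≤n))) (ℕ.*-zeroʳ (suc i)))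
C-falling-step (suc n) zero = trans (ℕ.+-identityʳ _) (C-absorption n 0)
C-falling-step (suc n) (suc i) = begin
  suc (suc i) ℕ.* (suc n C suc (suc i)) ℕ.+ suc i ℕ.* (suc n C suc i)
    ≡⟨ cong₂ ℕ._+_ (C-absorption n (suc i)) (C-absorption n i) ⟩
  suc n ℕ.* (n C suc i) ℕ.+ suc n ℕ.* (n C i)
    ≡⟨ ℕ.*-distribˡ-+ (suc n) (n C suc i) (n C i) ⟨
  suc n ℕ.* ((n C suc i) ℕ.+ (n C i))
    ≡⟨ cong (suc n ℕ.*_) (trans (ℕ.+-comm (n C suc i) (n C i)) (nCk+nC[k+1]≡[n+1]C[k+1] n i)) ⟩
  suc n ℕ.* (suc n C suc i) ∎

falling : ℤ → ℕ → ℤ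
falling x zero    = 1ℤ
falling x (suc i) = (x - + i) * falling x i

i!*C≡falling : ∀ n i → + (i !) * + (n C i) ≡ falling (+ n) i
i!*C≡falling n zero    = refl
i!*C≡falling n (suc i) = begin
  + (suc i !) * + (n C suc i)
    ≡⟨ cong (_* + (n C suc i)) (pos-* (suc i) (i !)) ⟩
  + suc i * + (i !) * + (n C suc i)
    ≡⟨ regroup (+ suc i) (+ (i !)) (+ (n C suc i)) (+ i * + (n C i)) ⟩
  + (i !) * (+ suc i * + (n C suc i) + + i * + (n C i) - + i * + (n C i))
    ≡⟨ cong (λ z → + (i !) * (z - + i * + (n C i))) step ⟩
  + (i !) * (+ n * + (n C i) - + i * + (n C i))
    ≡⟨ factor (+ (i !)) (+ n) (+ (n C i)) (+ i) ⟩
  (+ n - + i) * (+ (i !) * + (n C i))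
    ≡⟨ cong ((+ n - + i) *_) (i!*C≡falling n i) ⟩
  (+ n - + i) * falling (+ n) i ∎
  where
  regroup : ∀ a b c d → a * b * c ≡ b * (a * c + d - d)
  regroup = solve-∀
  factor : ∀ a n c i → a * (n * c - i * c) ≡ (n - i) * (a * c)
  factor = solve-∀
  step : + suc i * + (n C suc i) + + i * + (n C i) ≡ + n * + (n C i)
  step = begin
    + suc i * + (n C suc i) + + i * + (n C i)
      ≡⟨ cong₂ _+_ (pos-* (suc i) (n C suc i)) (pos-* i (n C i)) ⟨
    + (suc i ℕ.* (n C suc i)) + + (i ℕ.* (n C i))
      ≡⟨ pos-+ (suc i ℕ.* (n C suc i)) (i ℕ.* (n C i)) ⟨
    + (suc i ℕ.* (n C suc i) ℕ.+ i ℕ.* (n C i))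
      ≡⟨ cong +_ (C-falling-step n i) ⟩
    + (n ℕ.* (n C i))
      ≡⟨ pos-* n (n C i) ⟩
    + n * + (n C i) ∎

5^-monoʳ-∣ : ∀ {m n} → m ≤ n → 5 ℕ.^ m ∣ 5 ℕ.^ n
5^-monoʳ-∣ z≤n       = ℕ.1∣ _
5^-monoʳ-∣ (s≤s m≤n) = ℕ.*-monoʳ-∣ 5 (5^-monoʳ-∣ m≤n)

-- The recursion divides i and 5ⁿ by 5 together as long as possible, so e is the smaller of n and
-- the exponent of 5 in i.
split-5-power : ∀ i n c → 1 ≤ i → 5 ℕ.^ n ∣ i ℕ.* c → ∃[ e ] 5 ℕ.^ e ∣ i × 5 ℕ.^ n ∣ 5 ℕ.^ e ℕ.* c
split-5-power = <-rec _ step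
  where
  P : ℕ → Set
  P i = ∀ n c → 1 ≤ i → 5 ℕ.^ n ∣ i ℕ.* c → ∃[ e ] 5 ℕ.^ e ∣ i × 5 ℕ.^ n ∣ 5 ℕ.^ e ℕ.* c
  positive : ∀ j → 1 ≤ j ℕ.* 5 → 1 ≤ j
  positive (suc j) _ = s≤s z≤n
  step : ∀ i → (∀ {j} → j < i → P j) → P i
  step i rec n c 1≤i 5ⁿ∣ic with 5 ∣? i
  step i rec n c 1≤i 5ⁿ∣ic | no 5∤i =
    0 , ℕ.1∣ i , subst (5 ℕ.^ n ∣_) (sym (ℕ.+-identityʳ c)) (prime-power-cancelˡ 5-prime 5∤i n c 5ⁿ∣ic)
  step i rec zero c 1≤i 5ⁿ∣ic | yes 5∣i = 0 , ℕ.1∣ i , ℕ.1∣ _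
  step .(j ℕ.* 5) rec (suc n) c 1≤i 5ⁿ∣ic | yes (ℕ.divides j refl)
    with e , 5ᵉ∣j , 5ⁿ∣5ᵉc ← rec {j} (ℕ.m<m*n j 5 {{ℕ.>-nonZero (positive j 1≤i)}} (s≤s (s≤s z≤n)))
           n c (positive j 1≤i)
           (ℕ.*-cancelˡ-∣ 5 (subst (5 ℕ.^ suc n ∣_) (trans (cong (ℕ._* c) (ℕ.*-comm j 5)) (ℕ.*-assoc 5 j c)) 5ⁿ∣ic))
    = suc e , subst (5 ℕ.^ suc e ∣_) (ℕ.*-comm 5 j) (ℕ.*-monoʳ-∣ 5 5ᵉ∣j)
      , subst (5 ℕ.^ suc n ∣_) (sym (ℕ.*-assoc 5 (5 ℕ.^ e) c)) (ℕ.*-monoʳ-∣ 5 5ⁿ∣5ᵉc)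

8+e≤5^[2+e] : ∀ e → 8 ℕ.+ e ≤ 5 ℕ.^ (2 ℕ.+ e)
8+e≤5^[2+e] zero    = from-yes (8 ℕ.≤? 25)
8+e≤5^[2+e] (suc e) = ℕ.≤-trans (ℕ.+-mono-≤ (ℕ.>-nonZero⁻¹ (5 ℕ.^ (2 ℕ.+ e)) {{ℕ.m^n≢0 5 (2 ℕ.+ e)}}) (8+e≤5^[2+e] e))
  (ℕ.+-monoʳ-≤ (5 ℕ.^ (2 ℕ.+ e)) (ℕ.m≤m+n (5 ℕ.^ (2 ℕ.+ e)) _))

-- For e = 1 the least candidate is 10, and for e ≥ 2 already 5ᵉ ≥ 6 + e. The bound fails at i = 5,
-- e = 1, so the fifth term of the logarithm is not part of the tail.
6+e≤i : ∀ {e i} → 6 ≤ i → 5 ℕ.^ e ∣ i → 6 ℕ.+ e ≤ i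
6+e≤i {zero}        6≤i _ = 6≤i
6+e≤i {suc zero}    6≤i (ℕ.divides (suc (suc q)) refl) = ℕ.≤-trans (from-yes (7 ℕ.≤? 10)) (ℕ.m≤m+n 10 (q ℕ.* 5))
6+e≤i {suc zero}    6≤i (ℕ.divides 0 refl) = contradiction 6≤i λ ()
6+e≤i {suc zero}    6≤i (ℕ.divides 1 refl) = contradiction 6≤i (from-no (6 ℕ.≤? 5))
6+e≤i {suc (suc e)} (s≤s _) 5ᵉ∣i = ℕ.≤-trans (8+e≤5^[2+e] e) (ℕ.∣⇒≤ 5ᵉ∣i)

∣i*C : ∀ {d n} i → d ∣ n → 1 ≤ i → d ∣ i ℕ.* (n C i)
∣i*C {d} {zero}  (suc i) _   _ = subst (λ z → d ∣ suc i ℕ.* z) (sym (k>n⇒nCk≡0 {0} {suc i} (s≤s z≤n)))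
  (subst (d ∣_) (sym (ℕ.*-zeroʳ (suc i))) (d ℕ.∣0))
∣i*C {d} {suc n} (suc i) d∣n _ = subst (d ∣_) (sym (C-absorption n i)) (ℕ.∣m⇒∣m*n (n C i) d∣n)

-- As i C(K, i) is divisible by 5ⁿ, C(K, i) lacks at most a factor 5ᵉ dividing i, and 5ⁱ makes up
-- for it because i ≥ 6 + e.
5^[6+n]∣5^i*C : ∀ n {K} i → 5 ℕ.^ n ∣ K → 6 ≤ i → 5 ℕ.^ (6 ℕ.+ n) ∣ 5 ℕ.^ i ℕ.* (K C i)
5^[6+n]∣5^i*C n {K} i 5ⁿ∣K 6≤i
  with 1≤i ← ℕ.≤-trans (s≤s z≤n) 6≤i
  with e , 5ᵉ∣i , 5ⁿ∣5ᵉC ← split-5-power i n (K C i) 1≤i (∣i*C i 5ⁿ∣K 1≤i)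
  = ℕ.∣-trans
    (subst₂ _∣_ (sym (ℕ.^-distribˡ-+-* 5 6 n))
      (trans (sym (ℕ.*-assoc (5 ℕ.^ 6) (5 ℕ.^ e) (K C i))) (cong (ℕ._* (K C i)) (sym (ℕ.^-distribˡ-+-* 5 6 e))))
      (ℕ.*-monoʳ-∣ (5 ℕ.^ 6) 5ⁿ∣5ᵉC))
    (ℕ.*-monoˡ-∣ (K C i) (5^-monoʳ-∣ (6+e≤i {e} 6≤i 5ᵉ∣i)))

∣ᵤ-5^⇒∣ : ∀ n {x} → 5 ℕ.^ n ∣ x → (+ 5) ^ n ∣ℤ + x
∣ᵤ-5^⇒∣ n {x} 5ⁿ∣x = subst (_∣ℤ + x) (pos-^ 5 n) (∣ᵤ⇒∣ 5ⁿ∣x)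

newton-tail : ∀ {f} → Kummer f → ∀ n {K} → 5 ℕ.^ n ∣ K → ∀ a i → 6 ≤ i →
  (+ 5) ^ (6 ℕ.+ n) ∣ℤ + (K C i) * Δ^ i f a
newton-tail {f} kf n {K} 5ⁿ∣K a i 6≤i with divides q eq ← kf i a =
  subst ((+ 5) ^ (6 ℕ.+ n) ∣ℤ_) (sym rearrange)
    (∣m⇒∣m*n q (∣ᵤ-5^⇒∣ (6 ℕ.+ n) (5^[6+n]∣5^i*C n i 5ⁿ∣K 6≤i)))
  where
  c = K C i
  comm : ∀ c q p → c * (q * p) ≡ p * c * q
  comm = solve-∀
  rearrange : + c * Δ^ i f a ≡ + (5 ℕ.^ i ℕ.* c) * q
  rearrange = trans (cong (+ c *_) eq) (trans (comm (+ c) q ((+ 5) ^ i))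
    (cong (_* q) (trans (cong (_* + c) (sym (pos-^ 5 i))) (sym (pos-* (5 ℕ.^ i) c)))))

-- 120 times the truncation of log (1 + Δ) = Δ - Δ²/2 + Δ³/3 - Δ⁴/4 + Δ⁵/5 - ….
logΔ : (ℕ → ℤ) → ℕ → ℤ
logΔ f a = + 120 * Δ^ 1 f a + (- (+ 60) * Δ^ 2 f a + (+ 40 * Δ^ 3 f a + (- (+ 30) * Δ^ 4 f a + + 24 * Δ^ 5 f a)))

-- The coefficient of K² in 120 (f (a + K) - f a), read off the falling factorials in Newton's formula.
quadraticRest : ℤ → (ℕ → ℤ) → ℕ → ℤ
quadraticRest K f a = + 60 * Δ^ 2 f a + ((+ 20 * K - + 60) * Δ^ 3 f a
  + ((+ 5 * K * K - + 30 * K + + 55) * Δ^ 4 f a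
  + (K * K * K - + 10 * K * K + + 35 * K - + 50) * Δ^ 5 f a))

-- Multiplication by 5! turns the binomial coefficients into falling factorials. The coefficient of
-- K in K (K - 1) ⋯ (K - i + 1) / i! is (-1)^(i-1) / i, which gives the logarithm.
newton-head : ∀ f K a →
  + 120 * (+ (K C 1) * Δ^ 1 f a + (+ (K C 2) * Δ^ 2 f a + (+ (K C 3) * Δ^ 3 f a
    + (+ (K C 4) * Δ^ 4 f a + + (K C 5) * Δ^ 5 f a))))
  ≡ + K * logΔ f a + + K * + K * quadraticRest (+ K) f a
newton-head f K a = begin
  + 120 * (c 1 * d 1 + (c 2 * d 2 + (c 3 * d 3 + (c 4 * d 4 + c 5 * d 5))))
    ≡⟨ scale (c 1) (c 2) (c 3) (c 4) (c 5) (d 1) (d 2) (d 3) (d 4) (d 5) ⟩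
  + 120 * (+ 1 * c 1 * d 1) + (+ 60 * (+ 2 * c 2 * d 2) + (+ 20 * (+ 6 * c 3 * d 3)
    + (+ 5 * (+ 24 * c 4 * d 4) + + 120 * c 5 * d 5)))
    ≡⟨ cong₂ _+_ (term 1 (+ 120)) (cong₂ _+_ (term 2 (+ 60)) (cong₂ _+_ (term 3 (+ 20))
         (cong₂ _+_ (term 4 (+ 5)) (cong (_* d 5) (i!*C≡falling K 5))))) ⟩
  + 120 * (falling (+ K) 1 * d 1) + (+ 60 * (falling (+ K) 2 * d 2) + (+ 20 * (falling (+ K) 3 * d 3)
    + (+ 5 * (falling (+ K) 4 * d 4) + falling (+ K) 5 * d 5)))
    ≡⟨ expand (+ K) (d 1) (d 2) (d 3) (d 4) (d 5) ⟩
  + K * logΔ f a + + K * + K * quadraticRest (+ K) f a ∎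
  where
  c d : ℕ → ℤ
  c i = + (K C i)
  d i = Δ^ i f a
  term : ∀ i x → x * (+ (i !) * c i * d i) ≡ x * (falling (+ K) i * d i)
  term i x = cong (λ z → x * (z * d i)) (i!*C≡falling K i)
  scale : ∀ c₁ c₂ c₃ c₄ c₅ d₁ d₂ d₃ d₄ d₅ →
    + 120 * (c₁ * d₁ + (c₂ * d₂ + (c₃ * d₃ + (c₄ * d₄ + c₅ * d₅)))) ≡
    + 120 * (+ 1 * c₁ * d₁) + (+ 60 * (+ 2 * c₂ * d₂) + (+ 20 * (+ 6 * c₃ * d₃)
      + (+ 5 * (+ 24 * c₄ * d₄) + + 120 * c₅ * d₅)))
  scale = solve-∀
  expand : ∀ K d₁ d₂ d₃ d₄ d₅ →
    let f₁ = (K - + 0) * 1ℤ ; f₂ = (K - + 1) * f₁ ; f₃ = (K - + 2) * f₂ ; f₄ = (K - + 3) * f₃ ; f₅ = (K - + 4) * f₄ in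
    + 120 * (f₁ * d₁) + (+ 60 * (f₂ * d₂) + (+ 20 * (f₃ * d₃) + (+ 5 * (f₄ * d₄) + f₅ * d₅)))
    ≡ K * (+ 120 * d₁ + (- (+ 60) * d₂ + (+ 40 * d₃ + (- (+ 30) * d₄ + + 24 * d₅))))
      + K * K * (+ 60 * d₂ + ((+ 20 * K - + 60) * d₃
         + ((+ 5 * K * K - + 30 * K + + 55) * d₄
         + (K * K * K - + 10 * K * K + + 35 * K - + 50) * d₅)))
  expand = solve-∀

∣-*-pair : ∀ {d e x y} → d ∣ℤ x → e ∣ℤ y → d * e ∣ℤ x * y
∣-*-pair {d} {e} (divides p refl) (divides q refl) = divides (p * q) (interchange p d q e)
  where
  interchange : ∀ p d q e → p * d * (q * e) ≡ p * q * (d * e)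
  interchange = solve-∀

5^-monoʳ-∣ℤ : ∀ {m n} → m ≤ n → (+ 5) ^ m ∣ℤ (+ 5) ^ n
5^-monoʳ-∣ℤ {m} {n} m≤n = subst ((+ 5) ^ m ∣ℤ_) (pos-^ 5 n) (∣ᵤ-5^⇒∣ m (5^-monoʳ-∣ m≤n))

-- Only the Δ² term falls short of 5³, and its coefficient 60 supplies the missing factor 5.
5³∣quadraticRest : ∀ {f} → Kummer f → ∀ K a → (+ 5) ^ 3 ∣ℤ quadraticRest K f a
5³∣quadraticRest {f} kf K a =
  ∣m∣n⇒∣m+n (∣-*-pair {d = + 5} (divides (+ 12) refl) (kf 2 a))
  (∣m∣n⇒∣m+n (∣n⇒∣m*n (+ 20 * K - + 60) (kf 3 a))
  (∣m∣n⇒∣m+n (∣n⇒∣m*n (+ 5 * K * K - + 30 * K + + 55) (ℤ.∣-trans (divides (+ 5) refl) (kf 4 a)))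
             (∣n⇒∣m*n (K * K * K - + 10 * K * K + + 35 * K - + 50) (ℤ.∣-trans (divides (+ 25) refl) (kf 5 a)))))

-- The remainder is K² times a multiple of 5³, plus 120 times the Newton tail. The scaling by 120
-- raises the tail's 5⁶⁺ⁿ to 5⁷⁺ⁿ.
Kummer-log : ∀ {f} → Kummer f → ∀ n {K} → 4 ≤ n → 5 ℕ.^ n ∣ K → 5 ≤ K → ∀ a →
  (+ 5) ^ (7 ℕ.+ n) ∣ℤ + 120 * (f (a ℕ.+ K) - f a) - + K * logΔ f a
Kummer-log {f} kf n {K} 4≤n 5ⁿ∣K 5≤K a with o , 5+o≡K ← ℕ.m≤n⇒∃[o]m+o≡n 5≤K =
  subst ((+ 5) ^ (7 ℕ.+ n) ∣ℤ_) (sym (difference o 5+o≡K))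
    (∣m∣n⇒∣m+n quadratic (∣-*-pair {d = + 5} (divides (+ 24) refl)
      (∣-∑< o (t ∘ (6 ℕ.+_)) λ i _ → newton-tail kf n 5ⁿ∣K a (6 ℕ.+ i) (ℕ.m≤m+n 6 i))))
  where
  t : ℕ → ℤ
  t i = + (K C i) * Δ^ i f a
  powers : (+ 5) ^ n * (+ 5) ^ n * (+ 5) ^ 3 ≡ (+ 5) ^ (n ℕ.+ n ℕ.+ 3)
  powers = sym (trans (ℤ.^-distribˡ-+-* (+ 5) (n ℕ.+ n) 3) (cong (_* (+ 5) ^ 3) (ℤ.^-distribˡ-+-* (+ 5) n n)))
  7+n≤n+n+3 : 7 ℕ.+ n ≤ n ℕ.+ n ℕ.+ 3
  7+n≤n+n+3 = subst (_≤ n ℕ.+ n ℕ.+ 3) (ℕ.+-comm (4 ℕ.+ n) 3) (ℕ.+-monoˡ-≤ 3 (ℕ.+-monoˡ-≤ n 4≤n))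
  collect : ∀ x y z → + 120 * (1ℤ * x + (y + z) - x) ≡ + 120 * y + + 120 * z
  collect = solve-∀
  group : ∀ x₁ x₂ x₃ x₄ x₅ z → x₁ + (x₂ + (x₃ + (x₄ + (x₅ + z)))) ≡ x₁ + (x₂ + (x₃ + (x₄ + x₅))) + z
  group = solve-∀
  cancel : ∀ x y z → x + y + z - x ≡ y + z
  cancel = solve-∀
  T : ℕ → ℤ
  T o = ∑< o (t ∘ (6 ℕ.+_))
  quadratic : (+ 5) ^ (7 ℕ.+ n) ∣ℤ + K * + K * quadraticRest (+ K) f a
  -- The bound m ≥ 5 comes from here: 2 n + 3 ≥ n + 7 amounts to n ≥ 4.
  quadratic = ℤ.∣-trans (5^-monoʳ-∣ℤ 7+n≤n+n+3)
    (subst (_∣ℤ + K * + K * quadraticRest (+ K) f a) powers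
      (∣-*-pair (∣-*-pair (∣ᵤ-5^⇒∣ n 5ⁿ∣K) (∣ᵤ-5^⇒∣ n 5ⁿ∣K)) (5³∣quadraticRest kf (+ K) a)))
  newton : ∀ o → 5 ℕ.+ o ≡ K → f (a ℕ.+ K) ≡ 1ℤ * f a + (t 1 + (t 2 + (t 3 + (t 4 + t 5))) + T o)
  -- K ≥ 5 lets the sum over 0 ≤ i ≤ K split after i = 5.
  newton o 5+o≡K = trans (newton-forward f a K) (trans (cong (λ m → ∑< (suc m) t) (sym 5+o≡K))
    (cong (_+_ (1ℤ * f a)) (group (t 1) (t 2) (t 3) (t 4) (t 5) (T o))))
  difference : ∀ o → 5 ℕ.+ o ≡ K → + 120 * (f (a ℕ.+ K) - f a) - + K * logΔ f a
    ≡ + K * + K * quadraticRest (+ K) f a + + 120 * T o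
  difference o 5+o≡K = begin
    + 120 * (f (a ℕ.+ K) - f a) - + K * logΔ f a
      ≡⟨ cong (λ z → + 120 * (z - f a) - + K * logΔ f a) (newton o 5+o≡K) ⟩
    + 120 * (1ℤ * f a + (t 1 + (t 2 + (t 3 + (t 4 + t 5))) + T o) - f a) - + K * logΔ f a
      ≡⟨ cong (_- + K * logΔ f a) (collect (f a) (t 1 + (t 2 + (t 3 + (t 4 + t 5)))) (T o)) ⟩
    + 120 * (t 1 + (t 2 + (t 3 + (t 4 + t 5)))) + + 120 * T o - + K * logΔ f a
      ≡⟨ cong (λ z → z + + 120 * T o - + K * logΔ f a) (newton-head f K a) ⟩
    + K * logΔ f a + + K * + K * quadraticRest (+ K) f a + + 120 * T o - + K * logΔ f a
      ≡⟨ cancel (+ K * logΔ f a) (+ K * + K * quadraticRest (+ K) f a) (+ 120 * T o) ⟩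
    + K * + K * quadraticRest (+ K) f a + + 120 * T o ∎

-- The factor K contributes 5ⁿ to the error of replacing `logΔ` by 120 p; then 120 = 5 · 24 is
-- cancelled at the cost of one power of 5.
Kummer-difference : ∀ {f} → Kummer f → ∀ p a → (+ 5) ^ 7 ∣ℤ logΔ f a - + 120 * p →
  ∀ n {K} → 4 ≤ n → 5 ℕ.^ n ∣ K → 5 ≤ K →
  (+ 5) ^ (6 ℕ.+ n) ∣ℤ f (a ℕ.+ K) - f a - + K * p
Kummer-difference {f} kf p a 5⁷∣ n {K} 4≤n 5ⁿ∣K 5≤K =
  5^-cancelˡ 24 (from-no (5 ∣? 24)) (6 ℕ.+ n)
    (*-cancelˡ-∣ (+ 5) (subst ((+ 5) ^ (7 ℕ.+ n) ∣ℤ_) (combine (f (a ℕ.+ K)) (f a) (+ K) (logΔ f a) p)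
      (∣m∣n⇒∣m+n (Kummer-log kf n 4≤n 5ⁿ∣K 5≤K a)
        (subst (_∣ℤ + K * (logΔ f a - + 120 * p)) powers (∣-*-pair (∣ᵤ-5^⇒∣ n 5ⁿ∣K) 5⁷∣)))))
  where
  powers : (+ 5) ^ n * (+ 5) ^ 7 ≡ (+ 5) ^ (7 ℕ.+ n)
  powers = trans (sym (ℤ.^-distribˡ-+-* (+ 5) n 7)) (cong ((+ 5) ^_) (ℕ.+-comm n 7))
  combine : ∀ x y K l p → + 120 * (x - y) - K * l + K * (l - + 120 * p) ≡ + 5 * (+ 24 * (x - y - K * p))
  combine = solve-∀

-- Euler's totient at powers of 5

-- Counts in blocks of five. The enumeration f is arbitrary so that the induction can shift it by 5.
count-non-multiples : ∀ {P : Pred ℕ 0ℓ} (P? : Decidable P) q f →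
  (∀ i → P (f i) ⇔ (¬ 5 ∣ suc i)) → length (filter P? (applyUpTo f (q ℕ.* 5))) ≡ q ℕ.* 4
count-non-multiples {P} P? zero    f P⇔ = refl
count-non-multiples {P} P? (suc q) f P⇔ =
  trans (keep 0 (from-no (5 ∣? 1))) (cong suc
  (trans (keep 1 (from-no (5 ∣? 2))) (cong suc
  (trans (keep 2 (from-no (5 ∣? 3))) (cong suc
  (trans (keep 3 (from-no (5 ∣? 4))) (cong suc
  (trans (cong length (filter-reject P? (λ p → Equivalence.to (P⇔ 4) p ℕ.∣-refl)))
    (count-non-multiples P? q (λ i → f (5 ℕ.+ i)) λ i →
      mk⇔ (λ p 5∣ → Equivalence.to (P⇔ (5 ℕ.+ i)) p (ℕ.∣m∣n⇒∣m+n (ℕ.∣-refl {5}) 5∣))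
          (λ 5∤ → Equivalence.from (P⇔ (5 ℕ.+ i)) λ 5∣ → 5∤ (ℕ.∣m+n∣m⇒∣n 5∣ (ℕ.∣-refl {5}))))))))))))
  where
  keep : ∀ i {xs} → ¬ 5 ∣ suc i → length (filter P? (f i ∷ xs)) ≡ suc (length (filter P? xs))
  keep i 5∤ = cong length (filter-accept P? (Equivalence.from (P⇔ i) 5∤))

-- For the converse, a divisor d of i is prime to 5; if 5ⁿ⁺¹ = e d, then 5ⁿ⁺¹ divides e, which
-- forces d = 1.
coprime-5^⇔ : ∀ n i → Coprime i (5 ℕ.^ suc n) ⇔ (¬ 5 ∣ i)
coprime-5^⇔ n i = mk⇔ to from
  where
  to : Coprime i (5 ℕ.^ suc n) → ¬ 5 ∣ i
  to c 5∣i = contradiction (c (5∣i , ℕ.m∣m*n (5 ℕ.^ n))) λ ()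
  from : ¬ 5 ∣ i → Coprime i (5 ℕ.^ suc n)
  from 5∤i {d} (d∣i , ℕ.divides e 5ⁿ≡ed) = ℕ.*-cancelˡ-≡ d 1 (5 ℕ.^ suc n) {{ℕ.m^n≢0 5 (suc n)}}
    (trans (cong (ℕ._* d) 5ⁿ≡e) (trans (sym 5ⁿ≡ed) (sym (ℕ.*-identityʳ _))))
    where
    5ⁿ∣e : 5 ℕ.^ suc n ∣ e
    5ⁿ∣e = prime-power-cancelˡ 5-prime (λ 5∣d → 5∤i (ℕ.∣-trans 5∣d d∣i)) (suc n) e
      (ℕ.∣-reflexive (trans 5ⁿ≡ed (ℕ.*-comm e d)))
    5ⁿ≡e : 5 ℕ.^ suc n ≡ e
    5ⁿ≡e = ℕ.∣-antisym 5ⁿ∣e (ℕ.divides d (trans 5ⁿ≡ed (ℕ.*-comm e d)))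

φ-5^ : ∀ n → φ (5 ℕ.^ suc n) ≡ 5 ℕ.^ n ℕ.* 4
φ-5^ n = trans (cong (λ xs → length (filter (λ a → coprime? a (5 ℕ.^ suc n)) xs))
    (trans (map-applyUpTo id suc (5 ℕ.^ suc n)) (cong (applyUpTo suc) (ℕ.*-comm 5 (5 ℕ.^ n)))))
  (count-non-multiples (λ a → coprime? a (5 ℕ.^ suc n)) (5 ℕ.^ n) suc (λ i → coprime-5^⇔ n (suc i)))

-- Congruences determined by initial values

Δ^-Δ^ : ∀ i j f a → Δ^ i (Δ^ j f) a ≡ Δ^ (i ℕ.+ j) f a
Δ^-Δ^ zero    j f a = refl
Δ^-Δ^ (suc i) j f a = cong₂ _-_ (Δ^-Δ^ i j f (suc a)) (Δ^-Δ^ i j f a)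

-- Discrete analogue of a polynomial of degree < d being fixed by d values: induction on d for the
-- difference sequence, and on a through w (a + 1) = Δ w a + w a.
∣-initial-values : ∀ {N} d w → (∀ {i} → i < d → N ∣ℤ w i) → (∀ a → N ∣ℤ Δ^ d w a) → ∀ a → N ∣ℤ w a
∣-initial-values     zero    w init N∣Δ a       = N∣Δ a
∣-initial-values     (suc d) w init N∣Δ zero    = init (s≤s z≤n)
∣-initial-values {N} (suc d) w init N∣Δ (suc a) = subst (N ∣ℤ_) (cancel (w (suc a)) (w a))
  (∣m∣n⇒∣m+n
    (∣-initial-values d (Δ^ 1 w)
      (λ i<d → ∣m∣n⇒∣m-n (init (s≤s i<d)) (init (ℕ.m<n⇒m<1+n i<d)))
      (λ a → subst (N ∣ℤ_) (sym (trans (Δ^-Δ^ d 1 w a) (cong (λ e → Δ^ e w a) (ℕ.+-comm d 1)))) (N∣Δ a)) a)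
    (∣-initial-values (suc d) w init N∣Δ a))
  where
  cancel : ∀ x y → x - y + y ≡ x
  cancel = solve-∀

-- Leibniz rule for a factor X of constant slope c: the higher differences of X vanish, so two terms
-- remain.
Δ^-Leibniz : ∀ (X f : ℕ → ℤ) {c} → (∀ a → X (suc a) ≡ X a + c) → ∀ d a →
  Δ^ (suc d) (λ a → X a * f a) a ≡ X a * Δ^ (suc d) f a + c * + suc d * Δ^ d f (suc a)
Δ^-Leibniz X f {c} X-suc zero    a = trans (cong (λ z → z * f (suc a) - X a * f a) (X-suc a))
  (base (X a) c (f (suc a)) (f a))
  where
  base : ∀ x c p q → (x + c) * p - x * q ≡ x * (p - q) + c * + 1 * p
  base = solve-∀
Δ^-Leibniz X f {c} X-suc (suc d) a = trans
  (cong₂ _-_ (trans (Δ^-Leibniz X f X-suc d (suc a))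
               (cong (λ z → z * Δ^ (suc d) f (suc a) + c * + suc d * Δ^ d f (suc (suc a))) (X-suc a)))
             (Δ^-Leibniz X f X-suc d a))
  (step (X a) c (+ suc d) (Δ^ d f (suc (suc a))) (Δ^ d f (suc a)) (Δ^ (suc d) f a))
  where
  step : ∀ x c e p q r → (x + c) * (p - q) + c * e * p - (x * r + c * e * q)
                       ≡ x * (p - q - r) + c * (1ℤ + e) * (p - q)
  step = solve-∀

poly : List ℤ → ℤ → ℤ
poly []       x = 0ℤ
poly (c ∷ cs) x = c + x * poly cs x

Δ^-const : ∀ d c a → Δ^ (suc d) (λ _ → c) a ≡ 0ℤ
Δ^-const zero    c a = ℤ.+-inverseʳ c
Δ^-const (suc d) c a = cong₂ _-_ (Δ^-const d c (suc a)) (Δ^-const d c a)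

-- A list of d coefficients has degree below d. In the Horner form p + X f, the Leibniz rule leaves
-- only differences of f that vanish by induction.
Δ^-poly : ∀ (X : ℕ → ℤ) {c} → (∀ a → X (suc a) ≡ X a + c) → ∀ cs a →
  Δ^ (length cs) (λ a → poly cs (X a)) a ≡ 0ℤ
Δ^-poly X     X-suc []       a = refl
Δ^-poly X {c} X-suc (p ∷ cs) a = begin
  Δ^ (suc d) (λ a → p + X a * f a) a
    ≡⟨ Δ^-+ (λ _ → p) (λ a → X a * f a) (suc d) a ⟩
  Δ^ (suc d) (λ _ → p) a + Δ^ (suc d) (λ a → X a * f a) a
    ≡⟨ cong₂ _+_ (Δ^-const d p a) (Δ^-Leibniz X f X-suc d a) ⟩
  0ℤ + (X a * (Δ^ d f (suc a) - Δ^ d f a) + c * + suc d * Δ^ d f (suc a))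
    ≡⟨ cong₂ (λ x y → 0ℤ + (X a * (x - y) + c * + suc d * x)) (Δ^-poly X X-suc cs (suc a)) (Δ^-poly X X-suc cs a) ⟩
  0ℤ + (X a * (0ℤ - 0ℤ) + c * + suc d * 0ℤ)
    ≡⟨ vanish (X a) (c * + suc d) ⟩
  0ℤ ∎
  where
  d = length cs
  f : ℕ → ℤ
  f a = poly cs (X a)
  vanish : ∀ x y → 0ℤ + (x * 0ℤ + y * 0ℤ) ≡ 0ℤ
  vanish = solve-∀

-- Numerical check of the six initial values

tabulatedV : ℕ → ℕ → ℤ
tabulatedV h a = (1ℤ + (+ 5) ^ (2 ℕ.* h ℕ.+ 4 ℕ.* a)) * Vec.head (evenTable (h ℕ.+ 2 ℕ.* a))

V≗tabulatedV : ∀ h → V (2 ℕ.* h) ≗ tabulatedV h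
V≗tabulatedV h a = cong ((1ℤ + (+ 5) ^ (2 ℕ.* h ℕ.+ 4 ℕ.* a)) *_)
  (trans (cong U (sym (trans (ℕ.*-distribˡ-+ 2 h (2 ℕ.* a)) (cong (2 ℕ.* h ℕ.+_) (sym (ℕ.*-assoc 2 2 a))))))
    (U-evenTable (h ℕ.+ 2 ℕ.* a)))

-- Lowest degree first; the entry 0 stands for the missing fourth power of b.
coefficients₀ coefficients₂ : List ℤ
coefficients₀ = + 7545 ∷ + 5050 ∷ - (+ 5375) ∷ + 1250 ∷ + 3125 ∷ + 9375 ∷ []
coefficients₂ = - (+ 1575) ∷ + 5350 ∷ + 2250 ∷ + 7500 ∷ + 0 ∷ + 3125 ∷ []

-- Considered modulo 5⁷, since cancelling 120 costs one power of 5 and 5⁶ is wanted.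
residue : (ℕ → ℤ) → ℕ → List ℤ → ℕ → ℤ
residue f r cs a = logΔ f a - + 120 * poly cs (+ (r ℕ.+ 4 ℕ.* a))

-- Decided by evaluation: Δ⁵ at i = 5 reaches a = 10, that is, U 40.
residues₀ : ∀ {i} → i < 6 → (+ 5) ^ 7 ∣ℤ residue (tabulatedV 0) 0 coefficients₀ i
residues₀ = from-yes (ℕ.allUpTo? (λ i → (+ 5) ^ 7 ℤ.∣? residue (tabulatedV 0) 0 coefficients₀ i) 6)

residues₂ : ∀ {i} → i < 6 → (+ 5) ^ 7 ∣ℤ residue (tabulatedV 1) 2 coefficients₂ i
residues₂ = from-yes (ℕ.allUpTo? (λ i → (+ 5) ^ 7 ℤ.∣? residue (tabulatedV 1) 2 coefficients₂ i) 6)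

logΔ-cong : ∀ {f g} → f ≗ g → logΔ f ≗ logΔ g
logΔ-cong {f} {g} f≗g a = cong₂ _+_ (term (+ 120) 1) (cong₂ _+_ (term (- (+ 60)) 2)
  (cong₂ _+_ (term (+ 40) 3) (cong₂ _+_ (term (- (+ 30)) 4) (term (+ 24) 5))))
  where
  term : ∀ c i → c * Δ^ i f a ≡ c * Δ^ i g a
  term c i = cong (c *_) (Δ^-cong f≗g i a)

∣Δ^-+ : ∀ {N} i (f g : ℕ → ℤ) → (∀ a → N ∣ℤ Δ^ i f a) → (∀ a → N ∣ℤ Δ^ i g a) → ∀ a → N ∣ℤ Δ^ i (λ a → f a + g a) a
∣Δ^-+ {N} i f g N∣f N∣g a = subst (N ∣ℤ_) (sym (Δ^-+ f g i a)) (∣m∣n⇒∣m+n (N∣f a) (N∣g a))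

∣Δ^-* : ∀ {N} i c (f : ℕ → ℤ) → (∀ a → N ∣ℤ Δ^ i f a) → ∀ a → N ∣ℤ Δ^ i (λ a → c * f a) a
∣Δ^-* {N} i c f N∣f a = subst (N ∣ℤ_) (sym (Δ^-* c f i a)) (∣n⇒∣m*n c (N∣f a))

-- Six further differences of Δʲ⁺¹ f give Δ⁷⁺ʲ f, which the Kummer congruences make divisible by 5⁷.
5⁷∣Δ⁶logΔ : ∀ {f} → Kummer f → ∀ a → (+ 5) ^ 7 ∣ℤ Δ^ 6 (logΔ f) a
5⁷∣Δ⁶logΔ {f} kf =
  ∣Δ^-+ 6 (λ a → + 120 * Δ^ 1 f a) 
    (λ a → - (+ 60) * Δ^ 2 f a + (+ 40 * Δ^ 3 f a + (- (+ 30) * Δ^ 4 f a + + 24 * Δ^ 5 f a))) (term (+ 120) 0)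
  (∣Δ^-+ 6 (λ a → - (+ 60) * Δ^ 2 f a) (λ a → + 40 * Δ^ 3 f a + (- (+ 30) * Δ^ 4 f a + + 24 * Δ^ 5 f a)) (term (- (+ 60)) 1)
  (∣Δ^-+ 6 (λ a → + 40 * Δ^ 3 f a) (λ a → - (+ 30) * Δ^ 4 f a + + 24 * Δ^ 5 f a) (term (+ 40) 2)
  (∣Δ^-+ 6 (λ a → - (+ 30) * Δ^ 4 f a) (λ a → + 24 * Δ^ 5 f a) (term (- (+ 30)) 3) (term (+ 24) 4))))
  where
  term : ∀ c j a → (+ 5) ^ 7 ∣ℤ Δ^ 6 (λ a → c * Δ^ (suc j) f a) a
  term c j = ∣Δ^-* 6 c (Δ^ (suc j) f) λ a → subst ((+ 5) ^ 7 ∣ℤ_) (sym (Δ^-Δ^ 6 (suc j) f a))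
    (ℤ.∣-trans (5^-monoʳ-∣ℤ (subst (7 ≤_) (sym (ℕ.+-suc 6 j)) (ℕ.m≤m+n 7 j))) (kf (6 ℕ.+ suc j) a))

-- Both parts have sixth difference zero modulo 5⁷, the polynomial because it has six coefficients;
-- hence the first six values suffice.
5⁷∣residue : ∀ {f} → Kummer f → ∀ r cs → length cs ≡ 6 →
  (∀ {i} → i < 6 → (+ 5) ^ 7 ∣ℤ residue f r cs i) → ∀ a → (+ 5) ^ 7 ∣ℤ residue f r cs a
5⁷∣residue {f} kf r cs ∣cs∣≡6 init = ∣-initial-values 6 (residue f r cs) init λ a →
  subst ((+ 5) ^ 7 ∣ℤ_) (sym (Δ^-cong (λ a → neg (logΔ f a) (poly cs (X a))) 6 a))
    (∣Δ^-+ 6 (logΔ f) (λ a → - (+ 120) * poly cs (X a)) (5⁷∣Δ⁶logΔ kf)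
      (∣Δ^-* 6 (- (+ 120)) (λ a → poly cs (X a)) λ a → subst ((+ 5) ^ 7 ∣ℤ_)
        (sym (trans (cong (λ d → Δ^ d (λ a → poly cs (X a)) a) (sym ∣cs∣≡6)) (Δ^-poly X {+ 4} X-suc cs a))) (divides 0ℤ refl)) a)
  where
  X : ℕ → ℤ
  X a = + (r ℕ.+ 4 ℕ.* a)
  neg : ∀ x y → x - + 120 * y ≡ x + - (+ 120) * y
  neg = solve-∀
  shift : ∀ r a → r ℕ.+ 4 ℕ.* suc a ≡ r ℕ.+ 4 ℕ.* a ℕ.+ 4
  shift = ℕ-Solver.solve-∀
  X-suc : ∀ a → X (suc a) ≡ X a + + 4
  X-suc a = trans (cong +_ (shift r a)) (pos-+ (r ℕ.+ 4 ℕ.* a) 4)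

-- With m = n + 1 and K = 5ⁿ k one has k φ(5ᵐ) = 4 K, so moving the index of `U` by k φ(5ᵐ) moves a
-- by K.
U-congruence : ∀ h cs → length cs ≡ 6 →
  (∀ {i} → i < 6 → (+ 5) ^ 7 ∣ℤ residue (tabulatedV h) (2 ℕ.* h) cs i) →
  ∀ k n a → 1 ≤ k → 4 ≤ n → let b = 2 ℕ.* h ℕ.+ 4 ℕ.* a in
  U (k ℕ.* φ (5 ℕ.^ suc n) ℕ.+ b) - (1ℤ + (+ 5) ^ b) * U b
    ≡ (+ 5) ^ n * + k * poly cs (+ b) [mod 5 ℕ.^ (suc n ℕ.+ 5) ]
U-congruence h cs ∣cs∣≡6 init k n a 1≤k 4≤n =
  subst₂ _∣ℤ_ modulus difference
    (∣m∣n⇒∣m-n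
      (Kummer-difference (Kummer-V h) (poly cs (+ b)) a
        (5⁷∣residue (Kummer-V h) r cs ∣cs∣≡6
          (λ {i} i<6 → subst (λ z → (+ 5) ^ 7 ∣ℤ z - + 120 * poly cs (+ (r ℕ.+ 4 ℕ.* i)))
            (sym (logΔ-cong (V≗tabulatedV h) i)) (init i<6)) a)
        n 4≤n (ℕ.m∣m*n k) 5≤K)
      -- The value of V at a + K carries an extra 5ᴺ U N, which vanishes because N ≥ n + 6; the
      -- factor 1 + 5ᵇ at b stays.
      (∣m⇒∣m*n (U N) (5^-monoʳ-∣ℤ 6+n≤N)))
  where
  r = 2 ℕ.* h
  b = r ℕ.+ 4 ℕ.* a
  K = 5 ℕ.^ n ℕ.* k
  N = r ℕ.+ 4 ℕ.* (a ℕ.+ K)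
  6+n≤K : 6 ℕ.+ n ≤ K
  6+n≤K with e , refl ← ℕ.m≤n⇒∃[o]m+o≡n (ℕ.≤-trans (s≤s (s≤s z≤n)) 4≤n) =
    ℕ.≤-trans (8+e≤5^[2+e] e) (ℕ.m≤m*n (5 ℕ.^ (2 ℕ.+ e)) k {{ℕ.>-nonZero 1≤k}})
  5≤K : 5 ≤ K
  5≤K = ℕ.≤-trans (ℕ.m≤m+n 5 (suc n)) (subst (_≤ K) (sym (ℕ.+-suc 5 n)) 6+n≤K)
  6+n≤N : 6 ℕ.+ n ≤ N
  6+n≤N = ℕ.≤-trans 6+n≤K (ℕ.≤-trans (ℕ.m≤n+m K a) (ℕ.≤-trans (ℕ.m≤n*m (a ℕ.+ K) 4) (ℕ.m≤n+m (4 ℕ.* (a ℕ.+ K)) r)))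
  modulus : (+ 5) ^ (6 ℕ.+ n) ≡ + (5 ℕ.^ (suc n ℕ.+ 5))
  modulus = trans (sym (pos-^ 5 (6 ℕ.+ n))) (cong (λ e → + (5 ℕ.^ e)) (trans (sym (ℕ.+-suc 5 n)) (ℕ.+-comm 5 (suc n))))
  index : N ≡ k ℕ.* φ (5 ℕ.^ suc n) ℕ.+ b
  index = trans (rearrange r a (5 ℕ.^ n) k) (cong (λ z → k ℕ.* z ℕ.+ b) (sym (φ-5^ n)))
    where
    rearrange : ∀ r a p k → r ℕ.+ 4 ℕ.* (a ℕ.+ p ℕ.* k) ≡ k ℕ.* (p ℕ.* 4) ℕ.+ (r ℕ.+ 4 ℕ.* a)
    rearrange = ℕ-Solver.solve-∀
  K≡ : + K ≡ (+ 5) ^ n * + k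
  K≡ = trans (pos-* (5 ℕ.^ n) k) (cong (_* + k) (pos-^ 5 n))
  regroup : ∀ q u v t → (1ℤ + q) * u - v - t - q * u ≡ u - v - t
  regroup = solve-∀
  difference : V r (a ℕ.+ K) - V r a - + K * poly cs (+ b) - (+ 5) ^ N * U N
    ≡ U (k ℕ.* φ (5 ℕ.^ suc n) ℕ.+ b) - (1ℤ + (+ 5) ^ b) * U b - (+ 5) ^ n * + k * poly cs (+ b)
  difference = trans (regroup ((+ 5) ^ N) (U N) (V r a) (+ K * poly cs (+ b)))
    (cong₂ (λ m z → U m - V r a - z * poly cs (+ b)) index K≡)

-- The identity is proved for symbolic coefficients, with the powers written as the products they
-- unfold to, and then specialised by computation.
poly-coefficients₀ : ∀ x → poly coefficients₀ x ≡
  + 7545 + + 5050 * x - + 5375 * x ^ 2 + + 1250 * x ^ 3 + + 3125 * x ^ 4 + + 9375 * x ^ 5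
poly-coefficients₀ = powers (+ 7545) (+ 5050) (+ 5375) (+ 1250) (+ 3125) (+ 9375)
  where
  expand : ∀ c₀ c₁ c₂ c₃ c₄ c₅ x → let x² = x * (x * 1ℤ) ; x³ = x * x² ; x⁴ = x * x³ ; x⁵ = x * x⁴ in
    c₀ + x * (c₁ + x * (- c₂ + x * (c₃ + x * (c₄ + x * (c₅ + x * 0ℤ)))))
    ≡ c₀ + c₁ * x - c₂ * x² + c₃ * x³ + c₄ * x⁴ + c₅ * x⁵
  expand = solve-∀
  powers : ∀ c₀ c₁ c₂ c₃ c₄ c₅ x → poly (c₀ ∷ c₁ ∷ - c₂ ∷ c₃ ∷ c₄ ∷ c₅ ∷ []) x
    ≡ c₀ + c₁ * x - c₂ * x ^ 2 + c₃ * x ^ 3 + c₄ * x ^ 4 + c₅ * x ^ 5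
  powers = expand

poly-coefficients₂ : ∀ x → poly coefficients₂ x ≡
  - (+ 1575) + + 5350 * x + + 2250 * x ^ 2 + + 7500 * x ^ 3 + + 3125 * x ^ 5
poly-coefficients₂ = powers (- (+ 1575)) (+ 5350) (+ 2250) (+ 7500) (+ 3125)
  where
  expand : ∀ c₀ c₁ c₂ c₃ c₅ x → let x² = x * (x * 1ℤ) ; x³ = x * x² ; x⁵ = x * (x * x³) in
    c₀ + x * (c₁ + x * (c₂ + x * (c₃ + x * (0ℤ + x * (c₅ + x * 0ℤ)))))
    ≡ c₀ + c₁ * x + c₂ * x² + c₃ * x³ + c₅ * x⁵
  expand = solve-∀
  powers : ∀ c₀ c₁ c₂ c₃ c₅ x → poly (c₀ ∷ c₁ ∷ c₂ ∷ c₃ ∷ 0ℤ ∷ c₅ ∷ []) x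
    ≡ c₀ + c₁ * x + c₂ * x ^ 2 + c₃ * x ^ 3 + c₅ * x ^ 5
  powers = expand

≡0[mod4]⇒ : ∀ {b} → + b ≡ + 0 [mod 4 ] → ∃[ a ] b ≡ 4 ℕ.* a
≡0[mod4]⇒ {b} 4∣b with ℕ.divides a eq ← ∣⇒∣ᵤ (subst (+ 4 ∣ℤ_) (ℤ.+-identityʳ (+ b)) 4∣b) =
  a , trans eq (ℕ.*-comm a 4)

-- Adding 4 turns b - 2 into the natural number 2 + b, whose quotient by 4 is positive; 2 + b = 4 (q
-- + 1) gives b = 2 + 4 q.
≡2[mod4]⇒ : ∀ {b} → + b ≡ + 2 [mod 4 ] → ∃[ a ] b ≡ 2 ℕ.+ 4 ℕ.* a
≡2[mod4]⇒ {b} 4∣b-2 with ∣⇒∣ᵤ (subst (+ 4 ∣ℤ_) (shift (+ b)) (∣m∣n⇒∣m+n 4∣b-2 ℤ.∣-refl))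
  where
  shift : ∀ x → x - + 2 + + 4 ≡ + 2 + x
  shift = solve-∀
... | ℕ.divides (suc q) eq =
  q , trans (ℕ.suc-injective (ℕ.suc-injective eq)) (cong (2 ℕ.+_) (ℕ.*-comm q 4))

theorem3p1 : (k m b : ℕ) → 1 ≤ k → 5 ≤ m → 2 ∣ b →
    let x = + b in
    (x ≡ + 0 [mod 4 ] →
    U (k ℕ.* φ (5 ℕ.^ m) ℕ.+ b) - (+ 1 + (+ 5) ^ b) * U b
    ≡ (+ 5) ^ (m ∸ 1) * + k *
    (+ 7545 + + 5050 * x - + 5375 * x ^ 2 + + 1250 * x ^ 3
    + + 3125 * x ^ 4 + + 9375 * x ^ 5)
    [mod 5 ℕ.^ (m ℕ.+ 5) ])
    ×
    (x ≡ + 2 [mod 4 ] →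
    U (k ℕ.* φ (5 ℕ.^ m) ℕ.+ b) - (+ 1 + (+ 5) ^ b) * U b
    ≡ (+ 5) ^ (m ∸ 1) * + k *
    (- (+ 1575) + + 5350 * x + + 2250 * x ^ 2
    + + 7500 * x ^ 3 + + 3125 * x ^ 5)
    [mod 5 ℕ.^ (m ℕ.+ 5) ])
theorem3p1 k (suc n) b 1≤k (s≤s 4≤n) _ = case₀ , case₂
  where
  Goal : ℕ → ℤ → Set
  Goal b P = U (k ℕ.* φ (5 ℕ.^ suc n) ℕ.+ b) - (+ 1 + (+ 5) ^ b) * U b
    ≡ (+ 5) ^ n * + k * P [mod 5 ℕ.^ (suc n ℕ.+ 5) ]
  case₀ : + b ≡ + 0 [mod 4 ] → Goal b _
  -- The class of b modulo 4 selects the progression b = r + 4 a, with r = 0 here and r = 2 in the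
  -- other case.
  case₀ b≡0 with a , refl ← ≡0[mod4]⇒ {b} b≡0 =
    subst (Goal b) (poly-coefficients₀ (+ b)) (U-congruence 0 coefficients₀ refl residues₀ k n a 1≤k 4≤n)
  case₂ : + b ≡ + 2 [mod 4 ] → Goal b _
  case₂ b≡2 with a , refl ← ≡2[mod4]⇒ {b} b≡2 =
    subst (Goal b) (poly-coefficients₂ (+ b)) (U-congruence 1 coefficients₂ refl residues₂ k n a 1≤k 4≤n)
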